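{- The uniform substitution proof rule US is sound for differential game logic: for every dGL formula $\phi$ and every uniform substitution $\sigma$ that is admissible for $\phi$, if $\phi$ is valid then $\sigma(\phi)$ is valid.
   Context: **Syntax of differential game logic (dGL).** $\mathcal V$ is a countable set of variables; each $x\in\mathcal V$ has an associated differential variable $x'\in\mathcal V$ (an independent variable). Complements $U^{c}$ of $U\subseteq\mathcal V$ are in $\mathcal V$. With variables $x$, function symbols $f$ and predicate symbols $p$ (each with an arity $k\ge 0$), and game symbols $a$, the grammar is: terms $\theta,\eta ::= x \mid f(\theta_1,\dots,\theta_k)\mid \theta+\eta\mid\theta\cdot\eta\mid(\theta)'$; hybrid games $\alpha,\beta ::= a\mid x:=\theta\mid x'=\theta\,\&\,\psi\mid\, ?\psi\mid\alpha\cup\beta\mid\alpha;\beta\mid\alpha^*\mid\alpha^d$; formulas $\phi,\psi ::= \theta\ge\eta\mid p(\theta_1,\dots,\theta_k)\mid\neg\phi\mid\phi\wedge\psi\mid\exists x\,\phi\mid\langle\alpha\rangle\phi$. $\Sigma(e)$ is the set of function, predicate and game symbols occurring in the expression $e$. **Semantics.** A state is a map $\omega:\mathcal V\to\mathbb R$; $\mathcal S$ is the set of states; $\omega_x^r$ is $\omega$ with the value of $x$ changed to $r$. An interpretation $I$ maps each $k$-ary $f$ to a smooth function $I(f):\mathbb R^k\to\mathbb R$, each $k$-ary $p$ to $I(p)\subseteq\mathbb R^k$, and each game symbol $a$ to a monotone function $I(a):2^{\mathcal S}\to2^{\mathcal S}$ (if $X\subseteq Y$ then $I(a)(X)\subseteq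 I(a)(Y)$). The value $I\omega[\![\theta]\!]\in\mathbb R$ of a term is defined as usual, with $I\omega[\![(\theta)']\!]=\sum_{x\in\mathcal V}\omega(x')\,\frac{\partial I[\![\theta]\!]}{\partial x}(\omega)$. Formulas denote sets $I[\![\phi]\!]\subseteq\mathcal S$ and games denote functions $I[\![\alpha]\!]:2^{\mathcal S}\to2^{\mathcal S}$, by simultaneous induction: $I[\![\theta\ge\eta]\!]=\{\omega: I\omega[\![\theta]\!]\ge I\omega[\![\eta]\!]\}$; $I[\![p(\theta_1,\dots,\theta_k)]\!]=\{\omega:(I\omega[\![\theta_1]\!],\dots,I\omega[\![\theta_k]\!])\in I(p)\}$; $I[\![\neg\phi]\!]=\mathcal S\setminus I[\![\phi]\!]$; $I[\![\phi\wedge\psi]\!]=I[\![\phi]\!]\cap I[\![\psi]\!]$; $I[\![\exists x\,\phi]\!]=\{\omega:\omega_x^r\in I[\![\phi]\!]\text{ for some }r\in\mathbb R\}$; $I[\![\langle\alpha\rangle\phi]\!]=I[\![\alpha]\!](I[\![\phi]\!])$; $I[\![a]\!](X)=I(a)(X)$; $I[\![x:=\theta]\!](X)=\{\omega:\omega_x^{I\omega[\![\theta]\!]}\in X\}$; $I[\![?\psi]\!](X)=I[\![\psi]\!]\cap X$; $I[\![\alpha\cup\beta]\!](X)=I[\![\alpha]\!](X)\cup I[\![\beta]\!](X)$; $I[\![\alpha;\beta]\!](X)=I[\![\alpha]\!](I[\![\beta]\!](X))$; $I[\![\alpha^*]\!](X)=\bigcap\{Z\subseteq\mathcal S: X\cup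 I[\![\alpha]\!](Z)\subseteq Z\}$; $I[\![\alpha^d]\!](X)=\mathcal S\setminus I[\![\alpha]\!](\mathcal S\setminus X)$; $I[\![x'=\theta\,\&\,\psi]\!](X)$ is the set of $\omega$ for which there are $r\ge0$ and $\varphi:[0,r]\to\mathcal S$ with $\varphi(0)=\omega$ on $\{x'\}^c$, $\varphi(r)\in X$, and for all $0\le\zeta\le r$: $\varphi(\zeta)(x')=I\varphi(\zeta)[\![\theta]\!]$, $\varphi(\zeta)\in I[\![\psi]\!]$, $\varphi(\zeta)=\varphi(0)$ on $\{x,x'\}^c$, and, if $r>0$, the derivative of $t\mapsto\varphi(t)(x)$ at $\zeta$ exists and equals $\varphi(\zeta)(x')$. $\phi$ is valid in $I$ iff $I[\![\phi]\!]=\mathcal S$; $\phi$ is valid iff it is valid in all interpretations. **Static semantics.** For $X\subseteq\mathcal S$, $V\subseteq\mathcal V$, $\omega\in\mathcal S$ let $X{\uparrow}V=\{\nu\in\mathcal S:\exists\mu\in X,\ \mu=\nu\text{ on }V\}$ and $X{\downarrow}\omega(V)=\{\nu\in X:\nu=\omega\text{ on }V\}$. Free variables of a term $\theta$: $x\in FV(\theta)$ iff there are $I$ and $\omega,\tilde\omega$ with $\omega=\tilde\omega$ on $\{x\}^c$ and $I\omega[\![\theta]\!]\ne I\tilde\omega[\![\theta]\!]$. Of a formula $\phi$: $x\in FV(\phi)$ iff there are $I$ and $\omega=\tilde\omega$ on $\{x\}^c$ with $\omega\in I[\![\phi]\!]\not\ni\tilde\omega$. Bound variables of a game: $x\in BV(\alpha)$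 iff there are $I,\omega,X$ with $\omega\in I[\![\alpha]\!](X)$ but $\omega\notin I[\![\alpha]\!](X{\downarrow}\omega(\{x\}))$. **Uniform substitutions.** A uniform substitution $\sigma$ replaces some symbols: it maps function symbols (written $f(\cdot)$) to terms $\sigma f(\cdot)$, predicate symbols $p(\cdot)$ to formulas $\sigma p(\cdot)$, and game symbols $a$ to hybrid games $\sigma a$ (symbols not replaced stay unchanged). Here $\cdot$ is a reserved function symbol of arity 0 marking the position of the argument (for arity $k$, analogously a vector of $k$ such symbols). $FV(\sigma)=\bigcup_f FV(\sigma f(\cdot))\cup\bigcup_p FV(\sigma p(\cdot))$ over the function and predicate symbols replaced by $\sigma$. For $U\subseteq\mathcal V$, $\sigma$ is $U$-admissible for an expression $e$ iff $FV(\sigma|_{\Sigma(e)})\cap U=\emptyset$, where $\sigma|_{\Sigma(e)}$ only replaces symbols occurring in $e$. The application $\sigma(e)$ is defined recursively: $\sigma(x)=x$; $\sigma(f(\theta))=\{\cdot\mapsto\sigma(\theta)\}(\sigma f(\cdot))$; $\sigma(\theta+\eta)=\sigma(\theta)+\sigma(\eta)$; $\sigma(\theta\cdot\eta)=\sigma(\theta)\cdot\sigma(\eta)$; $\sigma((\theta)')=(\sigma(\theta))'$ if $\sigma$ is $\mathcal V$-admissible for $\theta$; $\sigma(\theta\ge\eta)=\sigma(\theta)\ge\sigma(\eta)$; $\sigma(p(\theta))=\{\cdot\mapsto\sigma(\theta)\}(\sigma p(\cdot))$; $\sigma(\neg\phi)=\neg\sigma(\phi)$; $\sigma(\phi\wedge\psi)=\sigma(\phi)\wedge\sigma(\psi)$;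 $\sigma(\exists x\,\phi)=\exists x\,\sigma(\phi)$ if $\sigma$ is $\{x\}$-admissible for $\phi$; $\sigma(\langle\alpha\rangle\phi)=\langle\sigma(\alpha)\rangle\sigma(\phi)$ if $\sigma$ is $BV(\sigma(\alpha))$-admissible for $\phi$; $\sigma(a)=\sigma a$; $\sigma(x:=\theta)=(x:=\sigma(\theta))$; $\sigma(x'=\theta\,\&\,\psi)=(x'=\sigma(\theta)\,\&\,\sigma(\psi))$ if $\sigma$ is $\{x,x'\}$-admissible for $\theta$ and $\psi$; $\sigma(?\psi)=\,?\sigma(\psi)$; $\sigma(\alpha\cup\beta)=\sigma(\alpha)\cup\sigma(\beta)$; $\sigma(\alpha;\beta)=\sigma(\alpha);\sigma(\beta)$ if $\sigma$ is $BV(\sigma(\alpha))$-admissible for $\beta$; $\sigma(\alpha^*)=(\sigma(\alpha))^*$ if $\sigma$ is $BV(\sigma(\alpha))$-admissible for $\alpha$; $\sigma(\alpha^d)=(\sigma(\alpha))^d$. $\sigma$ is admissible for $e$ iff all side conditions arising in the recursive computation of $\sigma(e)$ (including those of the auxiliary substitutions $\{\cdot\mapsto\sigma(\theta)\}$) are satisfied, so that $\sigma(e)$ is defined. -}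

module Defs where

open import Axiom.ExcludedMiddle using (ExcludedMiddle)
open import Algebra.Core using (Op₁; Op₂)
open import Algebra.Structures using (IsCommutativeRing)
open import Data.Bool.Base using (Bool; T; not; _∧_; _∨_; if_then_else_)
open import Data.Fin.Base using (Fin; fromℕ<)
open import Data.List.Base as List using (List)
open import Data.List.Membership.Propositional as List using ()
open import Data.List.Relation.Unary.Unique.Propositional using (Unique)
open import Data.Maybe.Base using (Maybe; just; nothing)
open import Data.Nat.Base using (ℕ; zero; suc)
open import Data.Nat.Properties as ℕ using ()
open import Data.Product.Base using (Σ; ∃; _×_; _,_; proj₁)
open import Data.Sum.Base using (inj₁; inj₂)
open import Data.Unit.Base using (⊤)
open import Data.Vec.Functional as Vector using (Vector)
open import Function.Base using (_∘_)
open import Function.Bundles using (_↣_)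
open import Level using (0ℓ)
open import Relation.Binary.Core using (Rel)
open import Relation.Binary.Definitions using (DecidableEquality)
open import Relation.Binary.PropositionalEquality.Core using (_≡_; _≢_)
open import Relation.Binary.Structures using (IsTotalOrder)
open import Relation.Nullary.Decidable using (yes; no; does; via-injection)
open import Relation.Nullary.Negation.Core using (¬_)
open import Relation.Unary using (Pred; _∈_; ｛_｝; ∁; ∅; U; _∪_; _⊥_; ⋃)

------------------------------------------------------------------------
-- The real numbers, up to isomorphism: a (Dedekind-)complete ordered field.

record CompleteOrderedField : Set₁ where
  infix  8 -_
  infixl 7 _*_
  infixl 6 _+_
  infix  4 _≤_
  field
    ℝ   : Set
    _+_ : Op₂ ℝ
    _*_ : Op₂ ℝ
    -_  : Op₁ ℝ
    0#  : ℝ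
    1#  : ℝ
    _≤_ : Rel ℝ 0ℓ
    isCommutativeRing : IsCommutativeRing _≡_ _+_ _*_ -_ 0# 1#
    0≢1               : 0# ≢ 1#
    inverse           : ∀ x → x ≢ 0# → ∃ λ y → x * y ≡ 1#
    isTotalOrder      : IsTotalOrder _≡_ _≤_
    +-monoʳ-≤         : ∀ z {x y} → x ≤ y → z + x ≤ z + y
    *-nonneg          : ∀ {x y} → 0# ≤ x → 0# ≤ y → 0# ≤ x * y

  UpperBound : Pred ℝ 0ℓ → Pred ℝ 0ℓ
  UpperBound P b = ∀ {x} → x ∈ P → x ≤ b

  field
    supremum : ∀ P → ∃ P → ∃ (UpperBound P) →
               ∃ λ s → UpperBound P s × (∀ {b} → UpperBound P b → s ≤ b)

module Analysis (em : ExcludedMiddle 0ℓ) (Reals : CompleteOrderedField) where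
  open CompleteOrderedField Reals public

  infixl 6 _-_
  infix  4 _<_

  _-_ : Op₂ ℝ
  x - y = x + - y

  _<_ : Rel ℝ 0ℓ
  x < y = x ≤ y × x ≢ y

  ∣_∣ : Op₁ ℝ
  ∣ x ∣ with IsTotalOrder.total isTotalOrder 0# x
  ... | inj₁ _ = x
  ... | inj₂ _ = - x

  ∑ : ∀ {k} → Vector ℝ k → ℝ
  ∑ = Vector.foldr _+_ 0#

  -- The derivative at a of the restriction of F to D is d.
  HasDerivWithin : Pred ℝ 0ℓ → (ℝ → ℝ) → ℝ → ℝ → Set
  HasDerivWithin D F a d =
    ∀ ε → 0# < ε → ∃ λ δ → 0# < δ ×
      (∀ t → t ∈ D → ∣ t - a ∣ ≤ δ → ∣ F t - F a - d * (t - a) ∣ ≤ ε * ∣ t - a ∣)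

  -- Total operator; the value 0 is a junk value for non-differentiable points.
  deriv : (ℝ → ℝ) → ℝ → ℝ
  deriv F a with em {∃ (HasDerivWithin U F a)}
  ... | yes (d , _) = d
  ... | no  _       = 0#

  -- F : ℝᵏ → ℝ is totally differentiable at v with gradient g
  -- (distances are measured in the ℓ¹ norm).
  HasGradient : ∀ {k} → (Vector ℝ k → ℝ) → Vector ℝ k → Vector ℝ k → Set
  HasGradient {k} F v g =
    ∀ ε → 0# < ε → ∃ λ δ → 0# < δ ×
      (∀ (h : Vector ℝ k) → ∑ (λ i → ∣ h i ∣) ≤ δ →
        ∣ F (λ i → v i + h i) - F v - ∑ (λ i → g i * h i) ∣ ≤ ε * ∑ (λ i → ∣ h i ∣))

  -- n-fold total differentiability.
  DifferentiableN : ∀ {k} → ℕ → (Vector ℝ k → ℝ) → Set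
  DifferentiableN zero    F = ⊤
  DifferentiableN {k} (suc n) F =
    Σ (Fin k → Vector ℝ k → ℝ) λ G →
      (∀ v → HasGradient F v (λ i → G i v)) × (∀ i → DifferentiableN n (G i))

  Smooth : ∀ {k} → (Vector ℝ k → ℝ) → Set
  Smooth F = ∀ n → DifferentiableN n F

------------------------------------------------------------------------
-- Powersets.  Under excluded middle a subset is the same thing as its
-- Boolean characteristic function.  Unlike Pred A 0ℓ, this powerset is
-- small, so that the intersection of all pre-fixpoints is again a subset.

Pow : Set → Set
Pow A = A → Bool

infix 4 _∊_ _⊑_

_∊_ : ∀ {A} → A → Pow A → Set
a ∊ X = T (X a)

_⊑_ : ∀ {A} → Rel (Pow A) 0ℓ
X ⊑ Y = ∀ {a} → a ∊ X → a ∊ Y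

infixr 7 _⊓_
infixr 6 _⊔_

_⊓_ _⊔_ : ∀ {A} → Op₂ (Pow A)
(X ⊓ Y) a = X a ∧ Y a
(X ⊔ Y) a = X a ∨ Y a

complement : ∀ {A} → Op₁ (Pow A)
complement X = not ∘ X

------------------------------------------------------------------------
-- Variables and symbols

record Variables : Set₁ where
  field
    Var          : Set
    countable    : Var ↣ ℕ
    _′           : Var → Var
    ′-injective  : ∀ {x y} → x ′ ≡ y ′ → x ≡ y
    ′-distinct   : ∀ x → x ′ ≢ x

  _≟_ : DecidableEquality Var
  _≟_ = via-injection countable ℕ._≟_

record Signature : Set₁ where
  field
    Fn : ℕ → Set
    Pr : ℕ → Set
    Gm : Set

module DGL (em : ExcludedMiddle 0ℓ) (Reals : CompleteOrderedField)
           (Vars : Variables) (Sig : Signature) where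
  open Analysis em Reals
  open Variables Vars
  open Signature Sig

  -- · 0, · 1, … are the reserved function symbols of arity 0;
  -- · 0, …, · (k - 1) mark the arguments of a k-ary symbol.
  data FnSym : ℕ → Set where
    sym : ∀ {k} → Fn k → FnSym k
    ·   : ℕ → FnSym 0

  data Symbol : Set where
    fn : ∀ {k} → FnSym k → Symbol
    pr : ∀ {k} → Pr k → Symbol
    gm : Gm → Symbol

  ----------------------------------------------------------------------
  -- Syntax

  infixl 6 _⊕_
  infixl 7 _⊗_

  data Term : Set where
    var : Var → Term
    fn  : ∀ {k} → FnSym k → Vector Term k → Term
    _⊕_ : Term → Term → Term
    _⊗_ : Term → Term → Term
    der : Term → Term

  data Game : Set
  data Fml : Set

  infix  5 _:=_ _′=_&_ _≥ᶠ_
  infixr 4 _⨾_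
  infixr 3 _∪ᵍ_ _∧ᶠ_

  data Game where
    gm     : Gm → Game
    _:=_   : Var → Term → Game
    _′=_&_ : Var → Term → Fml → Game
    test   : Fml → Game
    _∪ᵍ_   : Game → Game → Game
    _⨾_    : Game → Game → Game
    _*ᵍ    : Game → Game
    _ᵈ     : Game → Game

  data Fml where
    _≥ᶠ_ : Term → Term → Fml
    pr   : ∀ {k} → Pr k → Vector Term k → Fml
    ¬ᶠ_  : Fml → Fml
    _∧ᶠ_ : Fml → Fml → Fml
    ∃ᶠ   : Var → Fml → Fml
    ⟨_⟩_ : Game → Fml → Fml

  Σᵗ : Term → Pred Symbol 0ℓ
  Σᵗ (var x)       = ∅
  Σᵗ (fn {k} f θs) = ｛ fn f ｝ ∪ ⋃ (Fin k) (λ i → Σᵗ (θs i))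
  Σᵗ (θ ⊕ η)       = Σᵗ θ ∪ Σᵗ η
  Σᵗ (θ ⊗ η)       = Σᵗ θ ∪ Σᵗ η
  Σᵗ (der θ)       = Σᵗ θ

  Σᵍ : Game → Pred Symbol 0ℓ
  Σᶠ : Fml → Pred Symbol 0ℓ

  Σᵍ (gm a)       = ｛ gm a ｝
  Σᵍ (x := θ)     = Σᵗ θ
  Σᵍ (x ′= θ & ψ) = Σᵗ θ ∪ Σᶠ ψ
  Σᵍ (test ψ)     = Σᶠ ψ
  Σᵍ (α ∪ᵍ β)     = Σᵍ α ∪ Σᵍ β
  Σᵍ (α ⨾ β)      = Σᵍ α ∪ Σᵍ β
  Σᵍ (α *ᵍ)       = Σᵍ α
  Σᵍ (α ᵈ)        = Σᵍ α

  Σᶠ (θ ≥ᶠ η)      = Σᵗ θ ∪ Σᵗ η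
  Σᶠ (pr {k} p θs) = ｛ pr p ｝ ∪ ⋃ (Fin k) (λ i → Σᵗ (θs i))
  Σᶠ (¬ᶠ φ)        = Σᶠ φ
  Σᶠ (φ ∧ᶠ ψ)      = Σᶠ φ ∪ Σᶠ ψ
  Σᶠ (∃ᶠ x φ)      = Σᶠ φ
  Σᶠ (⟨ α ⟩ φ)     = Σᵍ α ∪ Σᶠ φ

  ----------------------------------------------------------------------
  -- Semantics

  State : Set
  State = Var → ℝ

  infixl 8 _[_↦_]

  _[_↦_] : State → Var → ℝ → State
  (ω [ x ↦ r ]) y = if does (x ≟ y) then r else ω y

  _≗_on_ : State → State → Pred Var 0ℓ → Set
  ω ≗ ν on W = ∀ {x} → x ∈ W → ω x ≡ ν x

  record Interp : Set where
    field
      fnᴵ     : ∀ {k} → FnSym k → Vector ℝ k → ℝ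
      prᴵ     : ∀ {k} → Pr k → Pow (Vector ℝ k)
      gmᴵ     : Gm → Pow State → Pow State
      smooth  : ∀ {k} (f : FnSym k) → Smooth (fnᴵ f)
      mono    : ∀ a {X Y} → X ⊑ Y → gmᴵ a X ⊑ gmᴵ a Y

  open Interp

  ∂ : Var → (State → ℝ) → State → ℝ
  ∂ x F ω = deriv (λ r → F (ω [ x ↦ r ])) (ω x)

  -- The sum over all variables of a function of finite support;
  -- 0 is a junk value for functions of infinite support.
  ∑ⱽ : (Var → ℝ) → ℝ
  ∑ⱽ g with em {∃ λ xs → Unique xs × (∀ x → x List.∉ xs → g x ≡ 0#)}
  ... | yes (xs , _) = List.foldr _+_ 0# (List.map g xs)
  ... | no  _        = 0#

  ⟦_⟧ᵗ : Term → Interp → State → ℝ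
  ⟦ var x ⟧ᵗ   I ω = ω x
  ⟦ fn f θs ⟧ᵗ I ω = fnᴵ I f (λ i → ⟦ θs i ⟧ᵗ I ω)
  ⟦ θ ⊕ η ⟧ᵗ   I ω = ⟦ θ ⟧ᵗ I ω + ⟦ η ⟧ᵗ I ω
  ⟦ θ ⊗ η ⟧ᵗ   I ω = ⟦ θ ⟧ᵗ I ω * ⟦ η ⟧ᵗ I ω
  ⟦ der θ ⟧ᵗ   I ω = ∑ⱽ λ x → ω (x ′) * ∂ x (⟦ θ ⟧ᵗ I) ω

  -- ω can reach X by following x′ = F within Q.
  record Flow (x : Var) (F : State → ℝ) (Q X : Pow State) (ω : State) : Set where
    field
      r   : ℝ
      0≤r : 0# ≤ r
      -- Only the restriction of φ to [0 , r] matters.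
      φ   : ℝ → State

    Interval : Pred ℝ 0ℓ
    Interval ζ = 0# ≤ ζ × ζ ≤ r

    field
      start    : φ 0# ≗ ω on ∁ ｛ x ′ ｝
      end      : φ r ∊ X
      slope    : ∀ ζ → ζ ∈ Interval → φ ζ (x ′) ≡ F (φ ζ)
      domain   : ∀ ζ → ζ ∈ Interval → φ ζ ∊ Q
      constant : ∀ ζ → ζ ∈ Interval → φ ζ ≗ φ 0# on ∁ (｛ x ｝ ∪ ｛ x ′ ｝)
      solution : ∀ ζ → ζ ∈ Interval → 0# < r →
                 HasDerivWithin Interval (λ t → φ t x) ζ (φ ζ (x ′))

  ⟦_⟧ᵍ : Game → Interp → Pow State → Pow State
  ⟦_⟧ᶠ : Fml → Interp → Pow State

  ⟦ gm a ⟧ᵍ       I X   = gmᴵ I a X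
  ⟦ x := θ ⟧ᵍ     I X ω = X (ω [ x ↦ ⟦ θ ⟧ᵗ I ω ])
  ⟦ x ′= θ & ψ ⟧ᵍ I X ω = does (em {Flow x (⟦ θ ⟧ᵗ I) (⟦ ψ ⟧ᶠ I) X ω})
  ⟦ test ψ ⟧ᵍ     I X   = ⟦ ψ ⟧ᶠ I ⊓ X
  ⟦ α ∪ᵍ β ⟧ᵍ     I X   = ⟦ α ⟧ᵍ I X ⊔ ⟦ β ⟧ᵍ I X
  ⟦ α ⨾ β ⟧ᵍ      I X   = ⟦ α ⟧ᵍ I (⟦ β ⟧ᵍ I X)
  ⟦ α *ᵍ ⟧ᵍ       I X ω = does (em {∀ Z → X ⊔ ⟦ α ⟧ᵍ I Z ⊑ Z → ω ∊ Z})
  ⟦ α ᵈ ⟧ᵍ        I X   = complement (⟦ α ⟧ᵍ I (complement X))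

  ⟦ θ ≥ᶠ η ⟧ᶠ  I ω = does (em {⟦ η ⟧ᵗ I ω ≤ ⟦ θ ⟧ᵗ I ω})
  ⟦ pr p θs ⟧ᶠ I ω = prᴵ I p (λ i → ⟦ θs i ⟧ᵗ I ω)
  ⟦ ¬ᶠ φ ⟧ᶠ    I   = complement (⟦ φ ⟧ᶠ I)
  ⟦ φ ∧ᶠ ψ ⟧ᶠ  I   = ⟦ φ ⟧ᶠ I ⊓ ⟦ ψ ⟧ᶠ I
  ⟦ ∃ᶠ x φ ⟧ᶠ  I ω = does (em {∃ λ r → ω [ x ↦ r ] ∊ ⟦ φ ⟧ᶠ I})
  ⟦ ⟨ α ⟩ φ ⟧ᶠ I   = ⟦ α ⟧ᵍ I (⟦ φ ⟧ᶠ I)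

  Valid : Fml → Set
  Valid φ = ∀ I ω → ω ∊ ⟦ φ ⟧ᶠ I

  ----------------------------------------------------------------------
  -- Static semantics

  infixl 6 _↓_⟨_⟩

  _↓_⟨_⟩ : Pow State → State → Pred Var 0ℓ → Pow State
  (X ↓ ω ⟨ W ⟩) ν = X ν ∧ does (em {ν ≗ ω on W})

  FVᵗ : Term → Pred Var 0ℓ
  FVᵗ θ x = ∃ λ I → ∃ λ ω → ∃ λ ν →
    ω ≗ ν on ∁ ｛ x ｝ × ⟦ θ ⟧ᵗ I ω ≢ ⟦ θ ⟧ᵗ I ν

  FVᶠ : Fml → Pred Var 0ℓ
  FVᶠ φ x = ∃ λ I → ∃ λ ω → ∃ λ ν →
    ω ≗ ν on ∁ ｛ x ｝ × ω ∊ ⟦ φ ⟧ᶠ I × ¬ ν ∊ ⟦ φ ⟧ᶠ I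

  BV : Game → Pred Var 0ℓ
  BV α x = ∃ λ I → ∃ λ ω → ∃ λ X →
    ω ∊ ⟦ α ⟧ᵍ I X × ¬ ω ∊ ⟦ α ⟧ᵍ I (X ↓ ω ⟨ ｛ x ｝ ⟩)

  ----------------------------------------------------------------------
  -- Uniform substitutions

  -- The symbols mapped to nothing are the ones that are not replaced.
  record Subst : Set where
    field
      fnˢ : ∀ {k} → FnSym k → Maybe Term
      prˢ : ∀ {k} → Pr k → Maybe Fml
      gmˢ : Gm → Maybe Game

  open Subst

  ·↦ : ∀ {k} → Vector Term k → Subst
  ·↦ {k} θs = record { fnˢ = replace ; prˢ = λ _ → nothing ; gmˢ = λ _ → nothing }
    where
    replace : ∀ {j} → FnSym j → Maybe Term
    replace (sym f) = nothing
    replace (· i) with i ℕ.<? k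
    ... | yes i<k = just (θs (fromℕ< i<k))
    ... | no  _   = nothing

  -- The free variables of the restriction of σ to the symbols in S.
  data FVˢ (σ : Subst) (S : Pred Symbol 0ℓ) (x : Var) : Set where
    fn : ∀ {k} (f : FnSym k) {θ} → fn f ∈ S → fnˢ σ f ≡ just θ → x ∈ FVᵗ θ → FVˢ σ S x
    pr : ∀ {k} (p : Pr k) {φ} → pr p ∈ S → prˢ σ p ≡ just φ → x ∈ FVᶠ φ → FVˢ σ S x

  -- σ is W-admissible for an expression whose symbols are S.
  _is_-admissible-for_ : Subst → Pred Var 0ℓ → Pred Symbol 0ℓ → Set
  σ is W -admissible-for S = FVˢ σ S ⊥ W

  -- The application of σ is a partial operation, given here by its graph:
  -- σ ⟪ e ⟫≔ e′ says that all side conditions arising in the computation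
  -- of σ(e) are satisfied and that its result is e′.  (Replacing an
  -- argument mark · i itself invokes the empty substitution on θs i.)

  infix 3 _⟪_⟫ᵗ≔_ _⟪_⟫ᵍ≔_ _⟪_⟫ᶠ≔_

  data _⟪_⟫ᵗ≔_ (σ : Subst) : Term → Term → Set where
    var : ∀ {x} →
          σ ⟪ var x ⟫ᵗ≔ var x
    fn-replaced : ∀ {k} {f : FnSym k} {θs θs′ θ θ′} →
          fnˢ σ f ≡ just θ →
          (∀ i → σ ⟪ θs i ⟫ᵗ≔ θs′ i) →
          ·↦ θs′ ⟪ θ ⟫ᵗ≔ θ′ →
          σ ⟪ fn f θs ⟫ᵗ≔ θ′
    fn-kept : ∀ {k} {f : FnSym k} {θs θs′} →
          fnˢ σ f ≡ nothing →
          (∀ i → σ ⟪ θs i ⟫ᵗ≔ θs′ i) →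
          σ ⟪ fn f θs ⟫ᵗ≔ fn f θs′
    _⊕_ : ∀ {θ θ′ η η′} →
          σ ⟪ θ ⟫ᵗ≔ θ′ →
          σ ⟪ η ⟫ᵗ≔ η′ →
          σ ⟪ θ ⊕ η ⟫ᵗ≔ θ′ ⊕ η′
    _⊗_ : ∀ {θ θ′ η η′} →
          σ ⟪ θ ⟫ᵗ≔ θ′ →
          σ ⟪ η ⟫ᵗ≔ η′ →
          σ ⟪ θ ⊗ η ⟫ᵗ≔ θ′ ⊗ η′
    der : ∀ {θ θ′} →
          σ is U -admissible-for Σᵗ θ →
          σ ⟪ θ ⟫ᵗ≔ θ′ →
          σ ⟪ der θ ⟫ᵗ≔ der θ′

  data _⟪_⟫ᵍ≔_ (σ : Subst) : Game → Game → Set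
  data _⟪_⟫ᶠ≔_ (σ : Subst) : Fml → Fml → Set

  data _⟪_⟫ᵍ≔_ σ where
    gm-replaced : ∀ {a α} →
          gmˢ σ a ≡ just α →
          σ ⟪ gm a ⟫ᵍ≔ α
    gm-kept : ∀ {a} →
          gmˢ σ a ≡ nothing →
          σ ⟪ gm a ⟫ᵍ≔ gm a
    assign : ∀ {x θ θ′} →
          σ ⟪ θ ⟫ᵗ≔ θ′ →
          σ ⟪ x := θ ⟫ᵍ≔ (x := θ′)
    ode : ∀ {x θ θ′ ψ ψ′} →
          σ is ｛ x ｝ ∪ ｛ x ′ ｝ -admissible-for Σᵗ θ →
          σ is ｛ x ｝ ∪ ｛ x ′ ｝ -admissible-for Σᶠ ψ →
          σ ⟪ θ ⟫ᵗ≔ θ′ →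
          σ ⟪ ψ ⟫ᶠ≔ ψ′ →
          σ ⟪ x ′= θ & ψ ⟫ᵍ≔ (x ′= θ′ & ψ′)
    test : ∀ {ψ ψ′} →
          σ ⟪ ψ ⟫ᶠ≔ ψ′ →
          σ ⟪ test ψ ⟫ᵍ≔ test ψ′
    _∪ᵍ_ : ∀ {α α′ β β′} →
          σ ⟪ α ⟫ᵍ≔ α′ →
          σ ⟪ β ⟫ᵍ≔ β′ →
          σ ⟪ α ∪ᵍ β ⟫ᵍ≔ (α′ ∪ᵍ β′)
    seq : ∀ {α α′ β β′} →
          σ ⟪ α ⟫ᵍ≔ α′ →
          σ is BV α′ -admissible-for Σᵍ β →
          σ ⟪ β ⟫ᵍ≔ β′ →
          σ ⟪ α ⨾ β ⟫ᵍ≔ (α′ ⨾ β′)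
    loop : ∀ {α α′} →
          σ ⟪ α ⟫ᵍ≔ α′ →
          σ is BV α′ -admissible-for Σᵍ α →
          σ ⟪ α *ᵍ ⟫ᵍ≔ (α′ *ᵍ)
    dual : ∀ {α α′} →
          σ ⟪ α ⟫ᵍ≔ α′ →
          σ ⟪ α ᵈ ⟫ᵍ≔ (α′ ᵈ)

  data _⟪_⟫ᶠ≔_ σ where
    _≥ᶠ_ : ∀ {θ θ′ η η′} →
          σ ⟪ θ ⟫ᵗ≔ θ′ →
          σ ⟪ η ⟫ᵗ≔ η′ →
          σ ⟪ θ ≥ᶠ η ⟫ᶠ≔ (θ′ ≥ᶠ η′)
    pr-replaced : ∀ {k} {p : Pr k} {θs θs′ φ φ′} →
          prˢ σ p ≡ just φ →
          (∀ i → σ ⟪ θs i ⟫ᵗ≔ θs′ i) →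
          ·↦ θs′ ⟪ φ ⟫ᶠ≔ φ′ →
          σ ⟪ pr p θs ⟫ᶠ≔ φ′
    pr-kept : ∀ {k} {p : Pr k} {θs θs′} →
          prˢ σ p ≡ nothing →
          (∀ i → σ ⟪ θs i ⟫ᵗ≔ θs′ i) →
          σ ⟪ pr p θs ⟫ᶠ≔ pr p θs′
    ¬ᶠ_ : ∀ {φ φ′} →
          σ ⟪ φ ⟫ᶠ≔ φ′ →
          σ ⟪ ¬ᶠ φ ⟫ᶠ≔ (¬ᶠ φ′)
    _∧ᶠ_ : ∀ {φ φ′ ψ ψ′} →
          σ ⟪ φ ⟫ᶠ≔ φ′ →
          σ ⟪ ψ ⟫ᶠ≔ ψ′ →
          σ ⟪ φ ∧ᶠ ψ ⟫ᶠ≔ (φ′ ∧ᶠ ψ′)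
    ∃ᶠ : ∀ {x φ φ′} →
          σ is ｛ x ｝ -admissible-for Σᶠ φ →
          σ ⟪ φ ⟫ᶠ≔ φ′ →
          σ ⟪ ∃ᶠ x φ ⟫ᶠ≔ ∃ᶠ x φ′
    diamond : ∀ {α α′ φ φ′} →
          σ ⟪ α ⟫ᵍ≔ α′ →
          σ is BV α′ -admissible-for Σᶠ φ →
          σ ⟪ φ ⟫ᶠ≔ φ′ →
          σ ⟪ ⟨ α ⟩ φ ⟫ᶠ≔ (⟨ α′ ⟩ φ′)

  Admissible : Subst → Fml → Set
  Admissible σ φ = ∃ λ φ′ → σ ⟪ φ ⟫ᶠ≔ φ′

  apply : ∀ σ φ → Admissible σ φ → Fml
  apply σ φ = proj₁

{-# OPTIONS --safe #-}
module Submission where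

open import Algebra.Bundles using (CommutativeRing)
import Algebra.Properties.AbelianGroup
import Algebra.Properties.Ring
import Algebra.Properties.Semiring.Mult.TCOptimised
import Algebra.Properties.Semiring.Sum
import Algebra.Solver.Ring
open import Algebra.Solver.Ring.AlmostCommutativeRing using
    (fromCommutativeRing; _-Raw-AlmostCommutative⟶_)
open import Axiom.ExcludedMiddle using (ExcludedMiddle)
open import Axiom.Extensionality.Propositional using (Extensionality)
open import Data.Bool.Base using (true; false; T; not; _∧_; _∨_; if_then_else_)
open import Data.Bool.Properties using (T-∧; T-∨; T?)
open import Data.Empty using (⊥-elim)
open import Data.Fin.Base using (Fin; zero; suc; fromℕ<; _↑ˡ_; _↑ʳ_; splitAt)
open import Data.Fin.Properties as Fin using ()
open import Data.Integer.Base as ℤ using (ℤ; -[1+_]; _⊖_)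
open import Data.Integer.Properties as ℤ using ()
open import Data.List.Base as List using (List; []; _∷_; _++_)
import Data.List.Membership.DecPropositional
open import Data.List.Membership.Propositional using () renaming (_∈_ to _∈ˡ_; _∉_ to _∉ˡ_)
open import Data.List.Membership.Propositional.Properties
open import Data.List.Relation.Unary.All as All using ()
open import Data.List.Relation.Unary.AllPairs using (_∷_)
open import Data.List.Relation.Unary.Any using (here; there; index)
open import Data.List.Relation.Unary.Any.Properties using (lookup-index)
open import Data.List.Relation.Unary.Unique.Propositional using (Unique)
import Data.List.Relation.Unary.Unique.DecPropositional.Properties
open import Data.Maybe.Base as Maybe using (Maybe; just; nothing; maybe′)
open import Data.Nat.Base as ℕ using (ℕ; zero; suc)
open import Data.Nat.Properties as ℕ using ()
open import Data.Product.Base using (∃; _×_; _,_; proj₁; proj₂)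
open import Data.Sum.Base using (_⊎_; inj₁; inj₂; [_,_])
open import Data.Unit.Base using (tt)
open import Data.Vec.Functional using (Vector)
open import Function.Base using (_∘_; id)
open import Function.Bundles using (Equivalence)
open import Level using (0ℓ)
open import Relation.Binary.Bundles using (Poset)
open import Relation.Binary.PropositionalEquality
  using (_≡_; _≢_; refl; sym; trans; cong; cong₂; subst; subst₂; module ≡-Reasoning)
import Relation.Binary.Reasoning.PartialOrder
open import Relation.Binary.Structures using (IsTotalOrder)
open import Relation.Nullary.Decidable using (Dec; yes; no; does; dec⇒maybe)
open import Relation.Nullary.Negation.Core using (¬_)
open import Relation.Unary using (Pred; _∈_; _∉_; ｛_｝; ∁; U; _∪_)
open import Defs

-- σ(φ) means in I what φ means in an adjoint interpretation, in which every
-- replaced symbol denotes its replacement at the current state.  That this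
-- interprets function symbols by smooth functions follows from the chain rule,
-- terms being smooth in finitely many arguments even if they contain
-- differentials.  The adjoint interpretation depends on the state only through
-- FV(σ), so admissibility keeps it fixed below a binder, given that formulas
-- depend only on their free variables and games change only their bound ones.
--
-- The latter two facts are not immediate since FV and BV are defined by
-- changes of single variables, whereas game symbols may act on infinitely many
-- variables at once.  However, an expression only mentions a finite set W of
-- variables, and it cannot distinguish permutations of the projections of the
-- states to ∁ W except by its game symbols, whose interpretation is arbitrary.
-- So if a single variable outside of W is not free (or not bound), then none
-- of the variables outside of W matter, not even jointly.

module RealAnalysis (em : ExcludedMiddle 0ℓ) (ext : Extensionality 0ℓ 0ℓ)
    (Reals : CompleteOrderedField) where
  open Analysis em Reals

  -- Arithmetic and order in a complete ordered field.

  ℝ-commutativeRing : CommutativeRing 0ℓ 0ℓ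
  ℝ-commutativeRing = record { isCommutativeRing = isCommutativeRing }

  open CommutativeRing ℝ-commutativeRing public using
    (ring; semiring; +-abelianGroup; +-assoc; +-comm; +-identityˡ; +-identityʳ; -‿inverseʳ;
     *-comm; *-assoc; *-identityˡ; *-identityʳ; zeroˡ; zeroʳ; distribʳ)
  open Algebra.Properties.Ring ring using (-‿distribˡ-*; -‿distribʳ-*; -‿involutive; -0#≈0#)
  open Algebra.Properties.AbelianGroup +-abelianGroup using (⁻¹-∙-comm)
  open Algebra.Properties.Semiring.Mult.TCOptimised semiring renaming (_×_ to _·_) using
      (×-homo-+; ×1-homo-*; 1+×)
  open IsTotalOrder isTotalOrder public using ()
    renaming (refl to ≤-refl; trans to ≤-trans; antisym to ≤-antisym; total to ≤-total;
              reflexive to ≤-reflexive)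

  ≤-poset : Poset 0ℓ 0ℓ 0ℓ
  ≤-poset = record { isPartialOrder = IsTotalOrder.isPartialOrder isTotalOrder }

  module ≤-Reasoning = Relation.Binary.Reasoning.PartialOrder ≤-poset
  open ≤-Reasoning

  -- The canonical homomorphism from the integers. It supplies the ring solver with coefficients
  -- whose equality can be tested.
  fromℤ : ℤ → ℝ
  fromℤ (ℤ.+ n)    = n · 1#
  fromℤ -[1+ n ] = - (suc n · 1#)

  fromℤ-⊖ : ∀ m n → fromℤ (m ⊖ n) ≡ m · 1# - n · 1#
  fromℤ-⊖ m zero = sym (trans (cong (m · 1# +_) -0#≈0#) (+-identityʳ _))
  fromℤ-⊖ zero (suc n) = sym (+-identityˡ _)
  fromℤ-⊖ (suc m) (suc n) = begin-equality
    fromℤ (suc m ⊖ suc n)               ≡⟨ cong fromℤ (ℤ.[1+m]⊖[1+n]≡m⊖n m n) ⟩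
    fromℤ (m ⊖ n)                       ≡⟨ fromℤ-⊖ m n ⟩
    M - N                               ≡⟨ cong (_- N) (sym (+-identityʳ M)) ⟩
    M + 0# - N                          ≡⟨ cong (λ z → M + z - N) (sym (-‿inverseʳ 1#)) ⟩
    M + (1# - 1#) - N                   ≡⟨ cong (_- N) (sym (+-assoc M 1# (- 1#))) ⟩
    M + 1# - 1# - N                     ≡⟨ +-assoc _ _ _ ⟩
    M + 1# + (- 1# - N)                 ≡⟨ cong₂ _+_ (+-comm M 1#) (⁻¹-∙-comm 1# N) ⟩
    1# + M - (1# + N)                   ≡⟨ sym (cong₂ _-_ (1+× m 1#) (1+× n 1#)) ⟩
    suc m · 1# - suc n · 1#             ∎
    where M = m · 1# ; N = n · 1#

  fromℤ-homo-neg : ∀ i → fromℤ (ℤ.- i) ≡ - fromℤ i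
  fromℤ-homo-neg (ℤ.+ zero)  = sym -0#≈0#
  fromℤ-homo-neg (ℤ.+ suc n) = refl
  fromℤ-homo-neg -[1+ n ]  = sym (-‿involutive _)

  fromℤ-homo-+ : ∀ i j → fromℤ (i ℤ.+ j) ≡ fromℤ i + fromℤ j
  fromℤ-homo-+ (ℤ.+ m)    (ℤ.+ n)    = ×-homo-+ 1# m n
  fromℤ-homo-+ (ℤ.+ m)    -[1+ n ] = fromℤ-⊖ m (suc n)
  fromℤ-homo-+ -[1+ m ] (ℤ.+ n)    = trans (fromℤ-⊖ n (suc m)) (+-comm _ _)
  fromℤ-homo-+ -[1+ m ] -[1+ n ] = begin-equality
    - (suc (suc (m ℕ.+ n)) · 1#)      ≡⟨ cong (λ k → - (k · 1#)) (cong suc (sym (ℕ.+-suc m n))) ⟩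
    - ((suc m ℕ.+ suc n) · 1#)        ≡⟨ cong -_ (×-homo-+ 1# (suc m) (suc n)) ⟩
    - (suc m · 1# + suc n · 1#)       ≡⟨ sym (⁻¹-∙-comm _ _) ⟩
    - (suc m · 1#) - suc n · 1#       ∎

  fromℤ-homo-*⁺ : ∀ m j → fromℤ (ℤ.+ m ℤ.* j) ≡ m · 1# * fromℤ j
  fromℤ-homo-*⁺ m (ℤ.+ n) = trans (cong fromℤ (sym (ℤ.pos-* m n))) (×1-homo-* m n)
  fromℤ-homo-*⁺ m -[1+ n ] = begin-equality
    fromℤ (ℤ.+ m ℤ.* (ℤ.- ℤ.+ suc n))
      ≡⟨ cong fromℤ (sym (ℤ.neg-distribʳ-* (ℤ.+ m) (ℤ.+ suc n))) ⟩
    fromℤ (ℤ.- (ℤ.+ m ℤ.* ℤ.+ suc n))       ≡⟨ fromℤ-homo-neg (ℤ.+ m ℤ.* ℤ.+ suc n) ⟩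
    - fromℤ (ℤ.+ m ℤ.* ℤ.+ suc n)           ≡⟨ cong -_ (fromℤ-homo-*⁺ m (ℤ.+ suc n)) ⟩
    - (m · 1# * (suc n · 1#))           ≡⟨ -‿distribʳ-* _ _ ⟩
    m · 1# * - (suc n · 1#)             ∎
  fromℤ-homo-* : ∀ i j → fromℤ (i ℤ.* j) ≡ fromℤ i * fromℤ j
  fromℤ-homo-* (ℤ.+ m)  j = fromℤ-homo-*⁺ m j
  fromℤ-homo-* -[1+ m ] j = begin-equality
    fromℤ ((ℤ.- ℤ.+ suc m) ℤ.* j)         ≡⟨ cong fromℤ (sym (ℤ.neg-distribˡ-* (ℤ.+ suc m) j)) ⟩
    fromℤ (ℤ.- (ℤ.+ suc m ℤ.* j))         ≡⟨ fromℤ-homo-neg (ℤ.+ suc m ℤ.* j) ⟩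
    - fromℤ (ℤ.+ suc m ℤ.* j)             ≡⟨ cong -_ (fromℤ-homo-*⁺ (suc m) j) ⟩
    - (suc m · 1# * fromℤ j)            ≡⟨ -‿distribˡ-* _ _ ⟩
    - (suc m · 1#) * fromℤ j            ∎

  fromℤ-homomorphism : ℤ.+-*-rawRing -Raw-AlmostCommutative⟶ fromCommutativeRing ℝ-commutativeRing
  fromℤ-homomorphism = record
    { ⟦_⟧ = fromℤ ; +-homo = fromℤ-homo-+ ; *-homo = fromℤ-homo-* ; -‿homo = fromℤ-homo-neg
    ; 0-homo = refl ; 1-homo = refl }

  open Algebra.Solver.Ring ℤ.+-*-rawRing (fromCommutativeRing ℝ-commutativeRing) fromℤ-homomorphism
    (λ i j → Maybe.map (cong fromℤ) (dec⇒maybe (i ℤ.≟ j)))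
    using (solve; _:=_; con; _:+_; _:*_; :-_; _:-_)


  x-x≡0 : ∀ x → x - x ≡ 0#
  x-x≡0 = -‿inverseʳ

  x-y+y≡x : ∀ x y → x - y + y ≡ x
  x-y+y≡x = solve 2 (λ x y → x :- y :+ y := x) refl

  x+y-y≡x : ∀ x y → x + y - y ≡ x
  x+y-y≡x = solve 2 (λ x y → x :+ y :- y := x) refl

  x+y-x≡y : ∀ x y → x + y - x ≡ y
  x+y-x≡y = solve 2 (λ x y → x :+ y :- x := y) refl

  x+[y-x]≡y : ∀ x y → x + (y - x) ≡ y
  x+[y-x]≡y = solve 2 (λ x y → x :+ (y :- x) := y) refl

  +-monoˡ-≤ : ∀ z {x y} → x ≤ y → x + z ≤ y + z
  +-monoˡ-≤ z {x} {y} x≤y = subst₂ _≤_ (+-comm z x) (+-comm z y) (+-monoʳ-≤ z x≤y)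

  +-mono-≤ : ∀ {x y z w} → x ≤ y → z ≤ w → x + z ≤ y + w
  +-mono-≤ {x} {y} {z} {w} p q = ≤-trans (+-monoˡ-≤ z p) (+-monoʳ-≤ y q)

  x≤y⇒0≤y-x : ∀ {x y} → x ≤ y → 0# ≤ y - x
  x≤y⇒0≤y-x {x} {y} p = subst (_≤ y - x) (x-x≡0 x) (+-monoˡ-≤ (- x) p)

  0≤y-x⇒x≤y : ∀ {x y} → 0# ≤ y - x → x ≤ y
  0≤y-x⇒x≤y {x} {y} p = subst₂ _≤_ (+-identityʳ x) (x+[y-x]≡y x y) (+-monoʳ-≤ x p)

  -‿anti-mono-≤ : ∀ {x y} → x ≤ y → - y ≤ - x
  -‿anti-mono-≤ {x} {y} p = 0≤y-x⇒x≤y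
      (subst (0# ≤_) (solve 2 (λ x y → y :- x := :- x :- :- y) refl x y) (x≤y⇒0≤y-x p))

  *-monoˡ-≤ : ∀ {x y z} → 0# ≤ z → x ≤ y → z * x ≤ z * y
  *-monoˡ-≤ {x} {y} {z} 0≤z x≤y = 0≤y-x⇒x≤y
    (subst (0# ≤_) (solve 3 (λ x y z → z :* (y :- x) := z :* y :- z :* x) refl x y z)
      (*-nonneg 0≤z (x≤y⇒0≤y-x x≤y)))

  *-monoʳ-≤ : ∀ {x y z} → 0# ≤ z → x ≤ y → x * z ≤ y * z
  *-monoʳ-≤ {x} {y} {z} 0≤z x≤y = subst₂ _≤_ (*-comm z x) (*-comm z y) (*-monoˡ-≤ 0≤z x≤y)

  ≤0⇒0≤- : ∀ {x} → x ≤ 0# → 0# ≤ - x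
  ≤0⇒0≤- {x} p = subst (_≤ - x) -0#≈0# (-‿anti-mono-≤ p)

  0≤⇒-≤0 : ∀ {x} → 0# ≤ x → - x ≤ 0#
  0≤⇒-≤0 {x} p = subst (- x ≤_) -0#≈0# (-‿anti-mono-≤ p)

  0≤1 : 0# ≤ 1#
  0≤1 with ≤-total 0# 1#
  ... | inj₁ p = p
  -- Even if 1 ≤ 0, the product (-1)(-1) = 1 of nonnegative factors is nonnegative.
  ... | inj₂ p = subst (0# ≤_) (solve 0 (:- con (ℤ.+ 1) :* :- con (ℤ.+ 1) := con (ℤ.+ 1)) refl)
                   (*-nonneg (≤0⇒0≤- p) (≤0⇒0≤- p))

  0<1 : 0# < 1#
  0<1 = 0≤1 , 0≢1

  x≤x+y : ∀ {x y} → 0# ≤ y → x ≤ x + y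
  x≤x+y {x} {y} p = subst (_≤ x + y) (+-identityʳ x) (+-monoʳ-≤ x p)

  x≤y+x : ∀ {x y} → 0# ≤ y → x ≤ y + x
  x≤y+x {x} {y} p = subst (x ≤_) (+-comm x y) (x≤x+y p)

  <-≤-trans : ∀ {x y z} → x < y → y ≤ z → x < z
  <-≤-trans (x≤y , x≢y) y≤z = ≤-trans x≤y y≤z , λ { refl → x≢y (≤-antisym x≤y y≤z) }

  +-nonneg : ∀ {x y} → 0# ≤ x → 0# ≤ y → 0# ≤ x + y
  +-nonneg p q = ≤-trans p (x≤x+y q)

  ∃-inverse : ∀ {x} → 0# < x → ∃ λ y → 0# < y × x * y ≡ 1#
  ∃-inverse {x} (0≤x , 0≢x) with inverse x (0≢x ∘ sym)
  ... | y , xy≡1 = y , (0≤y , λ { refl → 0≢1 (trans (sym (zeroʳ x)) xy≡1) }) , xy≡1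
    where
    0≤y : 0# ≤ y
    0≤y with ≤-total 0# y
    ... | inj₁ p = p
    -- If y ≤ 0, then 1 = x y ≤ 0, contradicting 0 ≤ 1 and 0 ≠ 1.
    ... | inj₂ p = ⊥-elim (0≢1 (≤-antisym 0≤1 (subst (_≤ 0#) xy≡1
                     (0≤y-x⇒x≤y (subst (0# ≤_)
                       (solve 2 (λ x y → x :* :- y := con (ℤ.+ 0) :- x :* y) refl x y)
                         (*-nonneg 0≤x (≤0⇒0≤- p)))))))

  *-pos : ∀ {x y} → 0# < x → 0# < y → 0# < x * y
  *-pos {x} {y} 0<x@(0≤x , 0≢x) (0≤y , 0≢y) with ∃-inverse 0<x
  ... | z , _ , xz≡1 = *-nonneg 0≤x 0≤y , λ 0≡xy → 0≢y (begin-equality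
      0#            ≡⟨ sym (zeroˡ z) ⟩
      0# * z        ≡⟨ cong (_* z) 0≡xy ⟩
      x * y * z     ≡⟨ solve 3 (λ x y z → x :* y :* z := y :* (x :* z)) refl x y z ⟩
      y * (x * z)   ≡⟨ cong (y *_) xz≡1 ⟩
      y * 1#        ≡⟨ *-identityʳ y ⟩
      y             ∎)

  0<1+x : ∀ {x} → 0# ≤ x → 0# < 1# + x
  0<1+x p = <-≤-trans 0<1 (x≤x+y p)

  abstract
    -- The choice is η = ε / (1 + C), whose denominator is positive even for C = 0. Every rescaling
    -- of an error bound below goes through it.
    shrink : ∀ {C ε} → 0# ≤ C → 0# < ε → ∃ λ η → 0# < η × C * η ≤ ε
    shrink {C} {ε} 0≤C 0<ε with ∃-inverse (0<1+x 0≤C)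
    ... | y , 0<y , eq = ε * y , 0<εy , ≤-trans (*-monoʳ-≤ (proj₁ 0<εy) (x≤y+x 0≤1))
        (≤-reflexive (begin-equality
        (1# + C) * (ε * y)
          ≡⟨ solve 3 (λ C ε y → (con (ℤ.+ 1) :+ C) :* (ε :* y) :=
                ε :* ((con (ℤ.+ 1) :+ C) :* y)) refl C ε y ⟩
        ε * ((1# + C) * y)   ≡⟨ cong (ε *_) eq ⟩
        ε * 1#               ≡⟨ *-identityʳ ε ⟩
        ε                    ∎))
      where
      0<εy : 0# < ε * y
      0<εy = *-pos 0<ε 0<y

    min : ∀ {x y} → 0# < x → 0# < y → ∃ λ z → 0# < z × z ≤ x × z ≤ y
    min {x} {y} p q with ≤-total x y
    ... | inj₁ x≤y = x , p , ≤-refl , x≤y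
    ... | inj₂ y≤x = y , q , y≤x , ≤-refl

  ∣x∣-cases : ∀ x → (0# ≤ x × ∣ x ∣ ≡ x) ⊎ (x ≤ 0# × ∣ x ∣ ≡ - x)
  ∣x∣-cases x with ≤-total 0# x
  ... | inj₁ p = inj₁ (p , refl)
  ... | inj₂ p = inj₂ (p , refl)

  0≤∣x∣ : ∀ x → 0# ≤ ∣ x ∣
  0≤∣x∣ x with ∣x∣-cases x
  ... | inj₁ (p , eq) = subst (0# ≤_) (sym eq) p
  ... | inj₂ (p , eq) = subst (0# ≤_) (sym eq) (≤0⇒0≤- p)

  x≤∣x∣ : ∀ x → x ≤ ∣ x ∣
  x≤∣x∣ x with ∣x∣-cases x
  ... | inj₁ (p , eq) = ≤-reflexive (sym eq)
  ... | inj₂ (p , eq) = ≤-trans p (0≤∣x∣ x)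

  -x≤∣x∣ : ∀ x → - x ≤ ∣ x ∣
  -x≤∣x∣ x with ∣x∣-cases x
  ... | inj₁ (p , eq) = ≤-trans (0≤⇒-≤0 p) (0≤∣x∣ x)
  ... | inj₂ (p , eq) = ≤-reflexive (sym eq)

  ∣x∣-least : ∀ {x y} → x ≤ y → - x ≤ y → ∣ x ∣ ≤ y
  ∣x∣-least {x} p q with ∣x∣-cases x
  ... | inj₁ (_ , eq) = subst (_≤ _) (sym eq) p
  ... | inj₂ (_ , eq) = subst (_≤ _) (sym eq) q

  0≤x⇒∣x∣≡x : ∀ {x} → 0# ≤ x → ∣ x ∣ ≡ x
  0≤x⇒∣x∣≡x {x} p = ≤-antisym (∣x∣-least ≤-refl (≤-trans (0≤⇒-≤0 p) p)) (x≤∣x∣ x)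

  ∣x+y∣≤∣x∣+∣y∣ : ∀ x y → ∣ x + y ∣ ≤ ∣ x ∣ + ∣ y ∣
  ∣x+y∣≤∣x∣+∣y∣ x y = ∣x∣-least (+-mono-≤ (x≤∣x∣ x) (x≤∣x∣ y))
    (subst (_≤ ∣ x ∣ + ∣ y ∣) (⁻¹-∙-comm x y) (+-mono-≤ (-x≤∣x∣ x) (-x≤∣x∣ y)))

  ∣-x∣≡∣x∣ : ∀ x → ∣ - x ∣ ≡ ∣ x ∣
  ∣-x∣≡∣x∣ x = ≤-antisym
    (∣x∣-least (-x≤∣x∣ x) (subst (_≤ ∣ x ∣) (sym (-‿involutive x)) (x≤∣x∣ x)))
    (∣x∣-least (subst (_≤ ∣ - x ∣) (-‿involutive x) (-x≤∣x∣ (- x))) (x≤∣x∣ (- x)))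

  -- Both sides are even in x and in y.
  ∣x*y∣≡∣x∣*∣y∣ : ∀ x y → ∣ x * y ∣ ≡ ∣ x ∣ * ∣ y ∣
  ∣x*y∣≡∣x∣*∣y∣ x y with ∣x∣-cases x | ∣x∣-cases y
  ... | inj₁ (p , p′) | inj₁ (q , q′) =
    trans (0≤x⇒∣x∣≡x (*-nonneg p q)) (sym (cong₂ _*_ p′ q′))
  ... | inj₁ (p , p′) | inj₂ (q , q′) = begin-equality
    ∣ x * y ∣       ≡⟨ sym (∣-x∣≡∣x∣ (x * y)) ⟩
    ∣ - (x * y) ∣   ≡⟨ cong ∣_∣ (-‿distribʳ-* x y) ⟩
    ∣ x * - y ∣     ≡⟨ 0≤x⇒∣x∣≡x (*-nonneg p (≤0⇒0≤- q)) ⟩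
    x * - y         ≡⟨ sym (cong₂ _*_ p′ q′) ⟩
    ∣ x ∣ * ∣ y ∣   ∎
  ... | inj₂ (p , p′) | inj₁ (q , q′) = begin-equality
    ∣ x * y ∣       ≡⟨ sym (∣-x∣≡∣x∣ (x * y)) ⟩
    ∣ - (x * y) ∣   ≡⟨ cong ∣_∣ (-‿distribˡ-* x y) ⟩
    ∣ - x * y ∣     ≡⟨ 0≤x⇒∣x∣≡x (*-nonneg (≤0⇒0≤- p) q) ⟩
    - x * y         ≡⟨ sym (cong₂ _*_ p′ q′) ⟩
    ∣ x ∣ * ∣ y ∣   ∎
  ... | inj₂ (p , p′) | inj₂ (q , q′) = begin-equality
    ∣ x * y ∣       ≡⟨ cong ∣_∣ (solve 2 (λ x y → x :* y := :- x :* :- y) refl x y) ⟩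
    ∣ - x * - y ∣   ≡⟨ 0≤x⇒∣x∣≡x (*-nonneg (≤0⇒0≤- p) (≤0⇒0≤- q)) ⟩
    - x * - y       ≡⟨ sym (cong₂ _*_ p′ q′) ⟩
    ∣ x ∣ * ∣ y ∣   ∎

  -- Finite sums of reals.

  open Algebra.Properties.Semiring.Sum semiring public using
      (*-distribˡ-sum; *-distribʳ-sum; ∑-distrib-+; ∑-comm; sum-cong-≗)

  ∑-nonneg : ∀ {k} {v : Vector ℝ k} → (∀ i → 0# ≤ v i) → 0# ≤ ∑ v
  ∑-nonneg {zero}  p = ≤-refl
  ∑-nonneg {suc k} p = +-nonneg (p zero) (∑-nonneg (p ∘ suc))

  term≤∑ : ∀ {k} {v : Vector ℝ k} → (∀ i → 0# ≤ v i) → ∀ i → v i ≤ ∑ v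
  term≤∑ p zero    = x≤x+y (∑-nonneg (p ∘ suc))
  term≤∑ p (suc i) = ≤-trans (term≤∑ (p ∘ suc) i) (x≤y+x (p zero))

  ∑-zero : ∀ {k} {v : Vector ℝ k} → (∀ i → v i ≡ 0#) → ∑ v ≡ 0#
  ∑-zero {zero}  p = refl
  ∑-zero {suc k} p = trans (cong₂ _+_ (p zero) (∑-zero (p ∘ suc))) (+-identityˡ 0#)

  ∑-single : ∀ {k} {v : Vector ℝ k} j → (∀ i → i ≢ j → v i ≡ 0#) → ∑ v ≡ v j
  ∑-single zero    p = trans (cong (_ +_) (∑-zero (λ i → p (suc i) λ ()))) (+-identityʳ _)
  ∑-single (suc j) p = trans (cong₂ _+_ (p zero λ ())
      (∑-single j (λ i i≢j → p (suc i) (i≢j ∘ Fin.suc-injective))))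
                         (+-identityˡ _)

  -- Differential calculus

  ‖_‖ : ∀ {k} → Vector ℝ k → ℝ
  ‖ h ‖ = ∑ (λ i → ∣ h i ∣)

  0≤‖_‖ : ∀ {k} (h : Vector ℝ k) → 0# ≤ ‖ h ‖
  0≤‖ h ‖ = ∑-nonneg (λ i → 0≤∣x∣ (h i))

  -- Landau's O(‖h‖) and o(‖h‖) as h tends to 0. `HasGradient F v g` unfolds to `o` of the remainder
  -- of the linear approximation.
  O o : ∀ {k} → (Vector ℝ k → ℝ) → Set
  O R = ∃ λ C → 0# ≤ C × ∃ λ δ → 0# < δ × (∀ h → ‖ h ‖ ≤ δ → ∣ R h ∣ ≤ C * ‖ h ‖)
  o R = ∀ ε → 0# < ε → ∃ λ δ → 0# < δ × (∀ h → ‖ h ‖ ≤ δ → ∣ R h ∣ ≤ ε * ‖ h ‖)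

  o⇒O : ∀ {k} {R : Vector ℝ k → ℝ} → o R → O R
  o⇒O oR = 1# , 0≤1 , oR 1# 0<1

  o-cong : ∀ {k} {R S : Vector ℝ k → ℝ} → (∀ h → R h ≡ S h) → o R → o S
  o-cong eq oR ε 0<ε with oR ε 0<ε
  ... | δ , 0<δ , p = δ , 0<δ , λ h q → subst (λ z → ∣ z ∣ ≤ _) (eq h) (p h q)

  O-cong : ∀ {k} {R S : Vector ℝ k → ℝ} → (∀ h → R h ≡ S h) → O R → O S
  O-cong eq (C , 0≤C , δ , 0<δ , p) = C , 0≤C , δ , 0<δ , λ h q →
    subst (λ z → ∣ z ∣ ≤ _) (eq h) (p h q)

  o-zero : ∀ {k} → o {k} (λ _ → 0#)
  o-zero ε 0<ε = 1# , 0<1 , λ h _ →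
    subst (_≤ ε * ‖ h ‖) (sym (0≤x⇒∣x∣≡x ≤-refl)) (*-nonneg (proj₁ 0<ε) 0≤‖ h ‖)

  O-+ : ∀ {k} {R S : Vector ℝ k → ℝ} → O R → O S → O (λ h → R h + S h)
  O-+ {R = R} {S} (C , 0≤C , δ , 0<δ , p) (D , 0≤D , δ′ , 0<δ′ , q) with min 0<δ 0<δ′
  ... | m , 0<m , m≤δ , m≤δ′ = C + D , +-nonneg 0≤C 0≤D , m , 0<m , λ h ‖h‖≤m → begin
    ∣ R h + S h ∣             ≤⟨ ∣x+y∣≤∣x∣+∣y∣ _ _ ⟩
    ∣ R h ∣ + ∣ S h ∣         ≤⟨ +-mono-≤ (p h (≤-trans ‖h‖≤m m≤δ)) (q h (≤-trans ‖h‖≤m m≤δ′)) ⟩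
    C * ‖ h ‖ + D * ‖ h ‖     ≡⟨ sym (distribʳ ‖ h ‖ C D) ⟩
    (C + D) * ‖ h ‖           ∎

  o-+ : ∀ {k} {R S : Vector ℝ k → ℝ} → o R → o S → o (λ h → R h + S h)
  o-+ {R = R} {S} oR oS ε 0<ε =
    let η , 0<η , 2η≤ε = shrink (+-nonneg 0≤1 0≤1) 0<ε
        δ , 0<δ , p = oR η 0<η
        δ′ , 0<δ′ , q = oS η 0<η
        m , 0<m , m≤δ , m≤δ′ = min 0<δ 0<δ′
    in m , 0<m , λ h ‖h‖≤m → begin
    ∣ R h + S h ∣             ≤⟨ ∣x+y∣≤∣x∣+∣y∣ _ _ ⟩
    ∣ R h ∣ + ∣ S h ∣         ≤⟨ +-mono-≤ (p h (≤-trans ‖h‖≤m m≤δ)) (q h (≤-trans ‖h‖≤m m≤δ′)) ⟩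
    η * ‖ h ‖ + η * ‖ h ‖     ≡⟨ double η ‖ h ‖ ⟩
    (1# + 1#) * η * ‖ h ‖     ≤⟨ *-monoʳ-≤ 0≤‖ h ‖ 2η≤ε ⟩
    ε * ‖ h ‖                 ∎
    where
    double : ∀ η n → η * n + η * n ≡ (1# + 1#) * η * n
    double = solve 2 (λ η n → η :* n :+ η :* n := (con (ℤ.+ 1) :+ con (ℤ.+ 1)) :* η :* n) refl

  O-scale : ∀ {k} c {R : Vector ℝ k → ℝ} → O R → O (λ h → c * R h)
  O-scale c {R} (C , 0≤C , δ , 0<δ , p) = ∣ c ∣ * C , *-nonneg (0≤∣x∣ c) 0≤C , δ , 0<δ , λ h ‖h‖≤δ →
    begin
    ∣ c * R h ∣             ≡⟨ ∣x*y∣≡∣x∣*∣y∣ c (R h) ⟩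
    ∣ c ∣ * ∣ R h ∣         ≤⟨ *-monoˡ-≤ (0≤∣x∣ c) (p h ‖h‖≤δ) ⟩
    ∣ c ∣ * (C * ‖ h ‖)     ≡⟨ sym (*-assoc _ _ _) ⟩
    ∣ c ∣ * C * ‖ h ‖       ∎

  o-scale : ∀ {k} c {R : Vector ℝ k → ℝ} → o R → o (λ h → c * R h)
  o-scale c {R} oR ε 0<ε with shrink (0≤∣x∣ c) 0<ε
  ... | η , 0<η , cη≤ε with oR η 0<η
  ... | δ , 0<δ , p = δ , 0<δ , λ h ‖h‖≤δ → begin
    ∣ c * R h ∣             ≡⟨ ∣x*y∣≡∣x∣*∣y∣ c (R h) ⟩
    ∣ c ∣ * ∣ R h ∣         ≤⟨ *-monoˡ-≤ (0≤∣x∣ c) (p h ‖h‖≤δ) ⟩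
    ∣ c ∣ * (η * ‖ h ‖)     ≡⟨ sym (*-assoc _ _ _) ⟩
    ∣ c ∣ * η * ‖ h ‖       ≤⟨ *-monoʳ-≤ 0≤‖ h ‖ cη≤ε ⟩
    ε * ‖ h ‖               ∎

  O-∑ : ∀ {k m} {R : Fin m → Vector ℝ k → ℝ} → (∀ j → O (R j)) → O (λ h → ∑ (λ j → R j h))
  O-∑ {m = zero}  p = o⇒O o-zero
  O-∑ {m = suc m} p = O-+ (p zero) (O-∑ (p ∘ suc))

  o-∑ : ∀ {k m} {R : Fin m → Vector ℝ k → ℝ} → (∀ j → o (R j)) → o (λ h → ∑ (λ j → R j h))
  o-∑ {m = zero}  p = o-zero
  o-∑ {m = suc m} p = o-+ (p zero) (o-∑ (p ∘ suc))

  O-abs : ∀ {k} {R : Vector ℝ k → ℝ} → O R → O (λ h → ∣ R h ∣)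
  O-abs {R = R} (C , 0≤C , δ , 0<δ , p) = C , 0≤C , δ , 0<δ , λ h q →
    subst (_≤ C * ‖ h ‖) (sym (0≤x⇒∣x∣≡x (0≤∣x∣ (R h)))) (p h q)

  O-linear : ∀ {k} (g : Vector ℝ k) → O (λ h → ∑ (λ i → g i * h i))
  O-linear g = O-∑ λ i → O-scale (g i) (1# , 0≤1 , 1# , 0<1 , λ h _ →
    ≤-trans (term≤∑ (λ j → 0≤∣x∣ (h j)) i) (≤-reflexive (sym (*-identityˡ ‖ h ‖))))

  -- Near 0 the increments satisfy ‖D h‖ ≤ C ‖h‖. So R is used with a tolerance η such that C η ≤ ε,
  -- and h is kept so small that C ‖h‖ stays within the radius that belongs to η.
  o∘O : ∀ {k m} {R : Vector ℝ m → ℝ} {D : Fin m → Vector ℝ k → ℝ} →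
        o R → (∀ j → O (D j)) → o (λ h → R (λ j → D j h))
  o∘O {R = R} {D} oR OD ε 0<ε with O-∑ (λ j → O-abs (OD j))
  ... | C , 0≤C , δ , 0<δ , p with shrink 0≤C 0<ε
  ... | η , 0<η , Cη≤ε with oR η 0<η
  ... | δ′ , 0<δ′ , q with shrink 0≤C 0<δ′
  ... | δ″ , 0<δ″ , Cδ″≤δ′ with min 0<δ 0<δ″
  ... | m , 0<m , m≤δ , m≤δ″ = m , 0<m , λ h ‖h‖≤m →
    let ‖D‖≤ : ‖ (λ j → D j h) ‖ ≤ C * ‖ h ‖
        ‖D‖≤ = ≤-trans (x≤∣x∣ _) (p h (≤-trans ‖h‖≤m m≤δ))
    in begin
    ∣ R (λ j → D j h) ∣
      ≤⟨ q _ (≤-trans ‖D‖≤ (≤-trans (*-monoˡ-≤ 0≤C (≤-trans ‖h‖≤m m≤δ″)) Cδ″≤δ′)) ⟩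
    η * ‖ (λ j → D j h) ‖    ≤⟨ *-monoˡ-≤ (proj₁ 0<η) ‖D‖≤ ⟩
    η * (C * ‖ h ‖)          ≡⟨ rearrange η C ‖ h ‖ ⟩
    C * η * ‖ h ‖            ≤⟨ *-monoʳ-≤ 0≤‖ h ‖ Cη≤ε ⟩
    ε * ‖ h ‖                ∎
    where
    rearrange : ∀ η C n → η * (C * n) ≡ C * η * n
    rearrange = solve 3 (λ η C n → η :* (C :* n) := C :* η :* n) refl

  -- The remainder of the composite is the remainder of F at the increments D, which is small by
  -- `o∘O`, plus the combination with coefficients g of the remainders of the inner functions.
  chain-rule : ∀ {k m} {F : Vector ℝ m → ℝ} {u : Fin m → Vector ℝ k → ℝ} {v g} 
               {L : Fin m → Vector ℝ k} →
               HasGradient F (λ j → u j v) g → (∀ j → HasGradient (u j) v (L j)) →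
               HasGradient (λ w → F (λ j → u j w)) v (λ i → ∑ (λ j → g j * L j i))
  chain-rule {k} {m} {F} {u} {v} {g} {L} F′ u′ =
    o-cong eq (o-+ (o∘O F′ OD) (o-∑ (λ j → o-scale (g j) (u′ j))))
    where
    D : Fin m → Vector ℝ k → ℝ
    D j h = u j (λ i → v i + h i) - u j v

    OD : ∀ j → O (D j)
    -- An increment is its remainder, which is o and hence O, plus its linear part.
    OD j = O-cong (λ h → x-y+y≡x (D j h) _) (O-+ (o⇒O (u′ j)) (O-linear (L j)))

    cancel : ∀ a b c d → a - b - c + (c - d) ≡ a - b - d
    cancel = solve 4 (λ a b c d → a :- b :- c :+ (c :- d) := a :- b :- d) refl

    expand : ∀ g d l → g * (d - l) + g * l ≡ g * d
    expand = solve 3 (λ g d l → g :* (d :- l) :+ g :* l := g :* d) refl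

    eq : ∀ h → F (λ j → u j v + D j h) - F (λ j → u j v) - ∑ (λ j → g j * D j h) +
               ∑ (λ j → g j * (D j h - ∑ (λ i → L j i * h i))) ≡
               F (λ j → u j (λ i → v i + h i)) - F (λ j → u j v) -
               ∑ (λ i → ∑ (λ j → g j * L j i) * h i)
    eq h = begin-equality
      F (λ j → u j v + D j h) - F₀ - ∑gD + ∑ (λ j → g j * (D j h - l j))
        ≡⟨ cong₂ (λ w z → F w - F₀ - ∑gD + z)
             (ext λ j → x+[y-x]≡y (u j v) _) lin ⟩
      F₁ - F₀ - ∑gD + (∑gD - ∑Lh)
        ≡⟨ cancel F₁ F₀ ∑gD ∑Lh ⟩
      F₁ - F₀ - ∑Lh ∎
      where
      F₀ = F (λ j → u j v)
      F₁ = F (λ j → u j (λ i → v i + h i))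
      ∑gD = ∑ (λ j → g j * D j h)
      ∑Lh = ∑ (λ i → ∑ (λ j → g j * L j i) * h i)
      l : Fin m → ℝ
      l j = ∑ (λ i → L j i * h i)

      ∑gl : ∑ (λ j → g j * l j) ≡ ∑Lh
      ∑gl = begin-equality
        ∑ (λ j → g j * l j)
          ≡⟨ sum-cong-≗ (λ j → *-distribˡ-sum (g j) (λ i → L j i * h i)) ⟩
        ∑ (λ j → ∑ (λ i → g j * (L j i * h i)))
          ≡⟨ ∑-comm (λ j i → g j * (L j i * h i)) ⟩
        ∑ (λ i → ∑ (λ j → g j * (L j i * h i)))
          ≡⟨ sum-cong-≗ (λ i → sum-cong-≗ (λ j → sym (*-assoc (g j) (L j i) (h i)))) ⟩
        ∑ (λ i → ∑ (λ j → g j * L j i * h i))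
          ≡⟨ sum-cong-≗ (λ i → sym (*-distribʳ-sum (h i) (λ j → g j * L j i))) ⟩
        ∑Lh ∎

      lin : ∑ (λ j → g j * (D j h - l j)) ≡ ∑gD - ∑Lh
      lin = begin-equality
        ∑ (λ j → g j * (D j h - l j))
          ≡⟨ sym (x+y-y≡x _ ∑Lh) ⟩
        ∑ (λ j → g j * (D j h - l j)) + ∑Lh - ∑Lh
          ≡⟨ cong (λ z → ∑ (λ j → g j * (D j h - l j)) + z - ∑Lh) (sym ∑gl) ⟩
        ∑ (λ j → g j * (D j h - l j)) + ∑ (λ j → g j * l j) - ∑Lh
          ≡⟨ cong (_- ∑Lh) (sym (∑-distrib-+ (λ j → g j * (D j h - l j)) (λ j → g j * l j))) ⟩
        ∑ (λ j → g j * (D j h - l j) + g j * l j) - ∑Lh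
          ≡⟨ cong (_- ∑Lh) (sum-cong-≗ (λ j → expand (g j) (D j h) (l j))) ⟩
        ∑gD - ∑Lh ∎

  -- Smooth functions and their closure properties.

  hasGradient-exact : ∀ {k} (F : Vector ℝ k → ℝ) v g →
                      (∀ h → F (λ i → v i + h i) - F v - ∑ (λ i → g i * h i) ≡ 0#) →
                      HasGradient F v g
  hasGradient-exact F v g eq = o-cong (λ h → sym (eq h)) o-zero

  differentiable-pred : ∀ {k} n {F : Vector ℝ k → ℝ} → DifferentiableN (suc n) F →
      DifferentiableN n F
  differentiable-pred zero    _             = tt
  differentiable-pred (suc n) (G , F′ , G′) = G , F′ , λ i → differentiable-pred n (G′ i)

  const-smooth : ∀ {k} c → Smooth {k} (λ _ → c)
  const-smooth c zero    = tt
  const-smooth {k} c (suc n) = (λ _ _ → 0#) ,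
      (λ v → hasGradient-exact (λ _ → c) v (λ _ → 0#) remainder≡0) , λ i → const-smooth 0# n
    where
    remainder≡0 : ∀ (h : Vector ℝ k) → c - c - ∑ (λ i → 0# * h i) ≡ 0#
    remainder≡0 h = begin-equality
      c - c - ∑ (λ i → 0# * h i)   ≡⟨ cong₂ _-_ (x-x≡0 c) (∑-zero (λ i → zeroˡ (h i))) ⟩
      0# - 0#                      ≡⟨ x-x≡0 0# ⟩
      0#                           ∎

  -- By extensionality the space of dimension 0 has a single point, so F is constant.
  smooth-nullary : (F : Vector ℝ 0 → ℝ) → Smooth F
  smooth-nullary F = subst Smooth (ext λ v → cong F (ext λ ())) (const-smooth (F λ ()))

  -- The Kronecker delta; `δ j` is the gradient of the projection to coordinate j.
  δ : ∀ {k} → Fin k → Fin k → ℝ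
  δ j i with i Fin.≟ j
  ... | yes _ = 1#
  ... | no  _ = 0#

  δ-refl : ∀ {k} (j : Fin k) → δ j j ≡ 1#
  δ-refl j with j Fin.≟ j
  ... | yes _ = refl
  ... | no ¬p = ⊥-elim (¬p refl)

  δ-≢ : ∀ {k} {i j : Fin k} → i ≢ j → δ j i ≡ 0#
  δ-≢ {i = i} {j} i≢j with i Fin.≟ j
  ... | yes p = ⊥-elim (i≢j p)
  ... | no  _ = refl

  proj-smooth : ∀ {k} (j : Fin k) → Smooth (λ v → v j)
  proj-smooth j zero    = tt
  proj-smooth {k} j (suc n) = (λ i _ → δ j i) ,
      (λ v → hasGradient-exact (λ v → v j) v (δ j) (remainder≡0 v)) , λ i → const-smooth (δ j i) n
    where
    remainder≡0 : ∀ (v h : Vector ℝ k) → v j + h j - v j - ∑ (λ i → δ j i * h i) ≡ 0#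
    remainder≡0 v h = begin-equality
      v j + h j - v j - ∑ (λ i → δ j i * h i)
        ≡⟨ cong (λ z → v j + h j - v j - z)
          (∑-single j (λ i i≢j → trans (cong (_* h i) (δ-≢ i≢j)) (zeroˡ (h i)))) ⟩
      v j + h j - v j - δ j j * h j   ≡⟨ cong (λ z → v j + h j - v j - z * h j) (δ-refl j) ⟩
      v j + h j - v j - 1# * h j      ≡⟨ cancel (v j) (h j) ⟩
      0#                              ∎
      where
      cancel : ∀ a b → a + b - a - 1# * b ≡ 0#
      cancel = solve 2 (λ a b → a :+ b :- a :- con (ℤ.+ 1) :* b := con (ℤ.+ 0)) refl

  add₂ mul₂ : Vector ℝ 2 → ℝ
  add₂ v = v zero + v (suc zero)
  mul₂ v = v zero * v (suc zero)

  add₂-smooth : Smooth add₂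
  add₂-smooth zero    = tt
  add₂-smooth (suc n) = (λ _ _ → 1#) ,
      (λ v → hasGradient-exact add₂ v (λ _ → 1#)
        (λ h → cancel (v zero) (v (suc zero)) (h zero) (h (suc zero))))
                      , λ _ → const-smooth 1# n
    where
    cancel : ∀ a b c d → a + c + (b + d) - (a + b) - (1# * c + (1# * d + 0#)) ≡ 0#
    cancel = solve 4 (λ a b c d → a :+ c :+ (b :+ d) :- (a :+ b) :-
        (con (ℤ.+ 1) :* c :+ (con (ℤ.+ 1) :* d :+ con (ℤ.+ 0)))
                        := con (ℤ.+ 0)) refl

  -- The remainder is h₀ h₁, and ∣ h₀ ∣ ≤ ε where ‖ h ‖ ≤ ε.
  mul₂-smooth : Smooth mul₂
  mul₂-smooth zero    = tt
  mul₂-smooth (suc n) = G , (λ v → o-cong (remainder v) h₀h₁) , G-differentiable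
    where
    G : Fin 2 → Vector ℝ 2 → ℝ
    G zero       v = v (suc zero)
    G (suc zero) v = v zero

    G-differentiable : ∀ i → DifferentiableN n (G i)
    G-differentiable zero       = proj-smooth (suc zero) n
    G-differentiable (suc zero) = proj-smooth zero n

    h₀h₁ : o {2} (λ h → h zero * h (suc zero))
    h₀h₁ ε 0<ε = ε , 0<ε , λ h ‖h‖≤ε → begin
      ∣ h zero * h (suc zero) ∣         ≡⟨ ∣x*y∣≡∣x∣*∣y∣ _ _ ⟩
      ∣ h zero ∣ * ∣ h (suc zero) ∣
        ≤⟨ *-monoʳ-≤ (0≤∣x∣ _) (≤-trans (term≤∑ (λ i → 0≤∣x∣ (h i)) zero) ‖h‖≤ε) ⟩
      ε * ∣ h (suc zero) ∣
        ≤⟨ *-monoˡ-≤ (proj₁ 0<ε) (term≤∑ (λ i → 0≤∣x∣ (h i)) (suc zero)) ⟩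
      ε * ‖ h ‖                         ∎

    expand : ∀ a b c d → c * d ≡ (a + c) * (b + d) - a * b - (b * c + (a * d + 0#))
    expand = solve 4 (λ a b c d → c :* d := (a :+ c) :* (b :+ d) :- a :* b :-
        (b :* c :+ (a :* d :+ con (ℤ.+ 0)))) refl

    remainder : ∀ (v h : Vector ℝ 2) → h zero * h (suc zero) ≡
                mul₂ (λ i → v i + h i) - mul₂ v - ∑ (λ i → G i v * h i)
    remainder v h = expand (v zero) (v (suc zero)) (h zero) (h (suc zero))

  -- The chain rule turns the partial derivatives of a composite into sums of products, while sums
  -- and products are composites with `add₂` and `mul₂`. The mutual recursion is well-founded
  -- because `differentiable-∘` calls the others only at a smaller n.
  differentiable-∘ : ∀ n {k m} {F : Vector ℝ m → ℝ} {u : Fin m → Vector ℝ k → ℝ} →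
                     DifferentiableN n F → (∀ j → DifferentiableN n (u j)) →
                     DifferentiableN n (λ w → F (λ j → u j w))
  differentiable-+ : ∀ n {k} {F G : Vector ℝ k → ℝ} →
                     DifferentiableN n F → DifferentiableN n G → DifferentiableN n (λ w → F w + G w)
  differentiable-* : ∀ n {k} {F G : Vector ℝ k → ℝ} →
                     DifferentiableN n F → DifferentiableN n G → DifferentiableN n (λ w → F w * G w)
  differentiable-∑ : ∀ n {k m} {u : Fin m → Vector ℝ k → ℝ} →
                     (∀ j → DifferentiableN n (u j)) → DifferentiableN n (λ w → ∑ (λ j → u j w))

  differentiable-∘ zero    _ _ = tt
  differentiable-∘ (suc n) {F = F} {u} (G , F′ , G′) u′ =
      (λ i w → ∑ (λ j → G j (λ j → u j w) * proj₁ (u′ j) i w))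
    , (λ v → chain-rule {F = F} {u} (F′ (λ j → u j v)) (λ j → proj₁ (proj₂ (u′ j)) v))
    , (λ i → differentiable-∑ n λ j → differentiable-* n
        (differentiable-∘ n (G′ j) (λ j → differentiable-pred n (u′ j))) (proj₂ (proj₂ (u′ j)) i))

  differentiable-+ n {F = F} {G} p q =
    differentiable-∘ n {u = λ { zero → F ; (suc _) → G }}
        (add₂-smooth n) λ { zero → p ; (suc zero) → q }

  differentiable-* n {F = F} {G} p q =
    differentiable-∘ n {u = λ { zero → F ; (suc _) → G }}
        (mul₂-smooth n) λ { zero → p ; (suc zero) → q }

  differentiable-∑ n {m = zero}  p = const-smooth 0# n
  differentiable-∑ n {m = suc m} p = differentiable-+ n (p zero) (differentiable-∑ n (p ∘ suc))

  -- Derivatives in one variable and partial derivatives.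

  hasDeriv-unique : ∀ {F a d e} → HasDerivWithin U F a d → HasDerivWithin U F a e → d ≡ e
  hasDeriv-unique {F} {a} {d} {e} F′d F′e with em {d ≡ e}
  ... | yes d≡e = d≡e
  ... | no  d≢e = ⊥-elim (proj₂ (*-pos 0<η 0<m) (≤-antisym (proj₁ (*-pos 0<η 0<m)) ηm≤0))
    where
    x≤0∧-x≤0⇒x≡0 : ∀ {x} → x ≤ 0# → - x ≤ 0# → x ≡ 0#
    x≤0∧-x≤0⇒x≡0 {x} p q = ≤-antisym p (subst₂ _≤_ -0#≈0# (-‿involutive x) (-‿anti-mono-≤ q))

    0<∣d-e∣ : 0# < ∣ d - e ∣
    0<∣d-e∣ = 0≤∣x∣ _ , λ 0≡∣d-e∣ → d≢e (begin-equality
      d             ≡⟨ sym (x-y+y≡x d e) ⟩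
      d - e + e     ≡⟨ cong (_+ e) (x≤0∧-x≤0⇒x≡0 (subst (d - e ≤_) (sym 0≡∣d-e∣) (x≤∣x∣ _))
                                                 (subst (- (d - e) ≤_) (sym 0≡∣d-e∣) (-x≤∣x∣ _))) ⟩
      0# + e        ≡⟨ +-identityˡ e ⟩
      e             ∎)

    -- If d ≠ e, choose η with 3 η ≤ |d - e| and t = a + m within both radii. The two remainders
    -- give |d - e| m ≤ 2 η m, while 3 η m ≤ |d - e| m. Hence η m ≤ 0, although η and m are
    -- positive.
    3# = 1# + 1# + 1#

    step = shrink {3#} (+-nonneg (+-nonneg 0≤1 0≤1) 0≤1) 0<∣d-e∣
    η = proj₁ step
    0<η = proj₁ (proj₂ step)
    δ₁ = F′d η 0<η
    δ₂ = F′e η 0<η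
    step₂ = min (proj₁ (proj₂ δ₁)) (proj₁ (proj₂ δ₂))
    m = proj₁ step₂
    0<m = proj₁ (proj₂ step₂)
    t = a + m

    t-a≡m : t - a ≡ m
    t-a≡m = x+y-x≡y a m

    ∣t-a∣≡m : ∣ t - a ∣ ≡ m
    ∣t-a∣≡m = trans (cong ∣_∣ t-a≡m) (0≤x⇒∣x∣≡x (proj₁ 0<m))

    E : ℝ → ℝ
    E c = F t - F a - c * (t - a)

    Ed≤ : ∣ E d ∣ ≤ η * m
    Ed≤ = subst (λ z → ∣ E d ∣ ≤ η * z) ∣t-a∣≡m
      (proj₂ (proj₂ δ₁) t _ (subst (_≤ proj₁ δ₁) (sym ∣t-a∣≡m) (proj₁ (proj₂ (proj₂ step₂)))))

    Ee≤ : ∣ E e ∣ ≤ η * m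
    Ee≤ = subst (λ z → ∣ E e ∣ ≤ η * z) ∣t-a∣≡m
      (proj₂ (proj₂ δ₂) t _ (subst (_≤ proj₁ δ₂) (sym ∣t-a∣≡m) (proj₂ (proj₂ (proj₂ step₂)))))

    difference : ∀ d e f s → (d - e) * s ≡ (f - e * s) + - (f - d * s)
    difference = solve 4 (λ d e f s → (d :- e) :* s := (f :- e :* s) :+ :- (f :- d :* s)) refl

    regroup : ∀ η m → η * m + (η * m + η * m) ≡ (1# + 1# + 1#) * η * m
    regroup = solve 2 (λ η m → η :* m :+ (η :* m :+ η :* m) :=
        (con (ℤ.+ 1) :+ con (ℤ.+ 1) :+ con (ℤ.+ 1)) :* η :* m) refl

    bound : η * m + ∣ d - e ∣ * m ≤ ∣ d - e ∣ * m
    bound = begin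
      η * m + ∣ d - e ∣ * m               ≡⟨ cong (λ z → η * m + ∣ d - e ∣ * z) (sym ∣t-a∣≡m) ⟩
      η * m + ∣ d - e ∣ * ∣ t - a ∣       ≡⟨ cong (η * m +_) (sym (∣x*y∣≡∣x∣*∣y∣ (d - e) (t - a))) ⟩
      η * m + ∣ (d - e) * (t - a) ∣
        ≡⟨ cong (λ z → η * m + ∣ z ∣) (difference d e (F t - F a) (t - a)) ⟩
      η * m + ∣ E e + - E d ∣             ≤⟨ +-monoʳ-≤ (η * m) (∣x+y∣≤∣x∣+∣y∣ (E e) (- E d)) ⟩
      η * m + (∣ E e ∣ + ∣ - E d ∣)       ≡⟨ cong (λ z → η * m + (∣ E e ∣ + z)) (∣-x∣≡∣x∣ (E d)) ⟩
      η * m + (∣ E e ∣ + ∣ E d ∣)         ≤⟨ +-monoʳ-≤ (η * m) (+-mono-≤ Ee≤ Ed≤) ⟩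
      η * m + (η * m + η * m)             ≡⟨ regroup η m ⟩
      3# * η * m                          ≤⟨ *-monoʳ-≤ (proj₁ 0<m) (proj₂ (proj₂ step)) ⟩
      ∣ d - e ∣ * m                       ∎

    ηm≤0 : η * m ≤ 0#
    ηm≤0 = subst₂ _≤_ (x+y-y≡x (η * m) (∣ d - e ∣ * m)) (x-x≡0 (∣ d - e ∣ * m))
        (+-monoˡ-≤ (- (∣ d - e ∣ * m)) bound)

  -- `deriv` takes whatever derivative excluded middle delivers; uniqueness identifies it with d.
  deriv-≡ : ∀ {F a d} → HasDerivWithin U F a d → deriv F a ≡ d
  deriv-≡ {F} {a} {d} F′ with em {∃ (HasDerivWithin U F a)}
  ... | yes (_ , F′e) = hasDeriv-unique F′e F′
  ... | no  ¬∃        = ⊥-elim (¬∃ (d , F′))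

  deriv-const : ∀ {F : ℝ → ℝ} {a} → (∀ r → F r ≡ F a) → deriv F a ≡ 0#
  deriv-const {F} {a} const = deriv-≡ λ ε 0<ε → 1# , 0<1 , λ t _ _ →
    subst (_≤ ε * ∣ t - a ∣) (sym (trans (cong ∣_∣ (zero-remainder t)) (0≤x⇒∣x∣≡x ≤-refl)))
        (*-nonneg (proj₁ 0<ε) (0≤∣x∣ (t - a)))
    where
    cancel : ∀ x y → x - x - 0# * y ≡ 0#
    cancel = solve 2 (λ x y → x :- x :- con (ℤ.+ 0) :* y := con (ℤ.+ 0)) refl
    zero-remainder : ∀ t → F t - F a - 0# * (t - a) ≡ 0#
    zero-remainder t = trans (cong (λ z → z - F a - 0# * (t - a)) (const t)) (cancel (F a) (t - a))

  -- The displacement along coordinate i has norm |t - v i|, and only its i-th component survives in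
  -- the linear part. The line w is specified by its coordinates so that it can be instantiated with
  -- `moved` below.
  hasGradient⇒hasDeriv : ∀ {k} {F : Vector ℝ k → ℝ} {v g} (i : Fin k) (w : ℝ → Vector ℝ k) →
    (∀ r → w r i ≡ r) → (∀ r j → j ≢ i → w r j ≡ v j) →
    HasGradient F v g → HasDerivWithin U (λ r → F (w r)) (v i) (g i)
  hasGradient⇒hasDeriv {k} {F} {v} {g} i w w-i w-j F′ ε 0<ε with F′ ε 0<ε
  ... | δ′ , 0<δ′ , p = δ′ , 0<δ′ , λ t _ ∣t-vi∣≤δ′ →
    subst₂ (λ x y → ∣ x ∣ ≤ ε * y) (remainder t) (norm t)
                          (p (h t) (subst (_≤ δ′) (sym (norm t)) ∣t-vi∣≤δ′))
    where
    h : ℝ → Vector ℝ k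
    h t j = w t j - v j

    h-i : ∀ t → h t i ≡ t - v i
    h-i t = cong (_- v i) (w-i t)

    h-j : ∀ t j → j ≢ i → h t j ≡ 0#
    h-j t j j≢i = trans (cong (_- v j) (w-j t j j≢i)) (x-x≡0 (v j))

    v+h≡w : ∀ t → (λ j → v j + h t j) ≡ w t
    v+h≡w t = ext λ j → x+[y-x]≡y (v j) (w t j)

    w[vi]≡v : w (v i) ≡ v
    w[vi]≡v = ext λ j → case-≡ j (j Fin.≟ i)
      where
      case-≡ : ∀ j → Dec (j ≡ i) → w (v i) j ≡ v j
      case-≡ j (yes refl) = w-i (v i)
      case-≡ j (no j≢i)   = w-j (v i) j j≢i

    norm : ∀ t → ‖ h t ‖ ≡ ∣ t - v i ∣
    norm t = trans (∑-single i (λ j j≢i → trans (cong ∣_∣ (h-j t j j≢i)) (0≤x⇒∣x∣≡x ≤-refl)))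
        (cong ∣_∣ (h-i t))

    remainder : ∀ t → F (λ j → v j + h t j) - F v - ∑ (λ j → g j * h t j) ≡
                F (w t) - F (w (v i)) - g i * (t - v i)
    remainder t = cong₂ _-_ (cong₂ (λ a b → F a - F b) (v+h≡w t) (sym w[vi]≡v))
      (trans (∑-single i (λ j j≢i → trans (cong (g j *_) (h-j t j j≢i)) (zeroʳ (g j))))
        (cong (g i *_) (h-i t)))

module UniformSubstitution
  (em : ExcludedMiddle 0ℓ) (ext : Extensionality 0ℓ 0ℓ)
  (Reals : CompleteOrderedField) (Vars : Variables) (Sig : Signature) where
  open Analysis em Reals
  open RealAnalysis em ext Reals
  open Variables Vars
  open Signature Sig
  open DGL em Reals Vars Sig renaming (sym to symbol)
  open Interp
  open Subst
  open Data.List.Membership.DecPropositional _≟_ using (_∈?_)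
  open Data.List.Relation.Unary.Unique.DecPropositional.Properties _≟_ using (deduplicate-!)
  open ≡-Reasoning

  -- Sums of finite support over the variables.

  if-yes : ∀ {A P : Set} {a b : A} (d : Dec P) → P → (if does d then a else b) ≡ a
  if-yes (yes _) _ = refl
  if-yes (no ¬p) p = ⊥-elim (¬p p)

  if-no : ∀ {A P : Set} {a b : A} (d : Dec P) → ¬ P → (if does d then a else b) ≡ b
  if-no (yes p) ¬p = ⊥-elim (¬p p)
  if-no (no _)  _  = refl

  index-unique : ∀ {xs : List Var} → Unique xs → ∀ i (p : List.lookup xs i ∈ˡ xs) → index p ≡ i
  index-unique (_ ∷ _)  zero    (here _)  = refl
  index-unique (x≢ ∷ _) zero    (there p) = ⊥-elim (All.lookup x≢ p refl)
  index-unique (x≢ ∷ _) (suc i) (here eq) = ⊥-elim (All.lookup x≢ (∈-lookup i) (sym eq))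
  index-unique (_ ∷ u)  (suc i) (there p) = cong suc (index-unique u i p)

  ∑-lookup : ∀ (g : Var → ℝ) xs → ∑ (λ i → g (List.lookup xs i)) ≡ List.foldr _+_ 0# (List.map g xs)
  ∑-lookup g []       = refl
  ∑-lookup g (x ∷ xs) = cong (g x +_) (∑-lookup g xs)

  -- Both sums equal the double sum of g x over the pairs x = y in xs × ys.
  ∑-support : ∀ {g : Var → ℝ} {xs ys} → Unique xs → Unique ys →
              (∀ x → x ∉ˡ xs → g x ≡ 0#) → (∀ x → x ∉ˡ ys → g x ≡ 0#) →
              ∑ (λ i → g (List.lookup xs i)) ≡ ∑ (λ j → g (List.lookup ys j))
  ∑-support {g} {xs} {ys} xs! ys! xs-supp ys-supp = begin
    ∑ (λ i → g (X i))                     ≡⟨ sum-cong-≗ (λ i → sym (row ys! ys-supp (X i))) ⟩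
    ∑ (λ i → ∑ (λ j → e (X i) (Y j)))     ≡⟨ ∑-comm (λ i j → e (X i) (Y j)) ⟩
    ∑ (λ j → ∑ (λ i → e (X i) (Y j)))
      ≡⟨ sum-cong-≗ (λ j → sum-cong-≗ (λ i → e-sym (X i) (Y j))) ⟩
    ∑ (λ j → ∑ (λ i → e (Y j) (X i)))     ≡⟨ sum-cong-≗ (λ j → row xs! xs-supp (Y j)) ⟩
    ∑ (λ j → g (Y j))                     ∎
    where
    X = List.lookup xs
    Y = List.lookup ys

    e : Var → Var → ℝ
    e x y = if does (x ≟ y) then g x else 0#

    e-≢ : ∀ x y → x ≢ y → e x y ≡ 0#
    e-≢ x y x≢y = if-no (x ≟ y) x≢y

    e-≡ : ∀ {x y} → x ≡ y → e x y ≡ g x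
    e-≡ {x} {y} x≡y = if-yes (x ≟ y) x≡y

    e-sym : ∀ x y → e x y ≡ e y x
    e-sym x y with x ≟ y
    ... | yes refl = refl
    ... | no x≢y   = trans (e-≢ x y x≢y) (sym (e-≢ y x (x≢y ∘ sym)))

    row : ∀ {zs} → Unique zs → (∀ x → x ∉ˡ zs → g x ≡ 0#) → 
          ∀ x → ∑ (λ j → e x (List.lookup zs j)) ≡ g x
    row {zs} zs! supp x with x ∈? zs
    ... | yes p = trans (∑-single (index p) λ j j≢p →
        e-≢ x (List.lookup zs j) λ { refl → j≢p (sym (index-unique zs! j p)) })
                        (e-≡ (lookup-index p))
    ... | no x∉zs = trans (∑-zero λ j → e-≢ x (List.lookup zs j) λ { refl → x∉zs (∈-lookup j) })
        (sym (supp x x∉zs))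

  -- `∑ⱽ` sums over some list that covers the support; by `∑-support` any other such list gives the
  -- same value.
  ∑ⱽ-≡ : ∀ {g xs} → Unique xs → (∀ x → x ∉ˡ xs → g x ≡ 0#) → ∑ⱽ g ≡ ∑ (λ i → g (List.lookup xs i))
  ∑ⱽ-≡ {g} {xs} xs! supp with em {∃ λ xs → Unique xs × (∀ x → x ∉ˡ xs → g x ≡ 0#)}
  ... | yes (ys , ys! , ys-supp) = trans (sym (∑-lookup g ys)) (∑-support ys! xs! ys-supp supp)
  ... | no ¬∃                    = ⊥-elim (¬∃ (xs , xs! , supp))

  -- Smoothness of terms

  infix 4 _⊆_

  _⊆_ : List Var → Pred Var 0ℓ → Set
  xs ⊆ W = ∀ {x} → x ∈ˡ xs → x ∈ W

  ++-⊆ˡ : ∀ {xs ys W} → xs ++ ys ⊆ W → xs ⊆ W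
  ++-⊆ˡ p = p ∘ ∈-++⁺ˡ

  ++-⊆ʳ : ∀ xs {ys W} → xs ++ ys ⊆ W → ys ⊆ W
  ++-⊆ʳ xs p = p ∘ ∈-++⁺ʳ xs

  concat-⊆ : ∀ {k} (xss : Fin k → List Var) {W} → List.concat (List.tabulate xss) ⊆ W → ∀ i →
      xss i ⊆ W
  concat-⊆ xss p i x∈ = p (∈-concat⁺′ x∈ (∈-tabulate⁺ i))

  -- A finite syntactic bound on the variables that can influence the value. The case of `der` adds
  -- the differential variables, since the value of (θ)′ is weighted by them.
  varsᵗ : Term → List Var
  varsᵗ (var x)   = x ∷ []
  varsᵗ (fn f θs) = List.concat (List.tabulate (λ i → varsᵗ (θs i)))
  varsᵗ (θ ⊕ η)   = varsᵗ θ ++ varsᵗ η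
  varsᵗ (θ ⊗ η)   = varsᵗ θ ++ varsᵗ η
  varsᵗ (der θ)   = varsᵗ θ ++ List.map _′ (varsᵗ θ)

  ↦-≡ : ∀ (ω : State) x r → (ω [ x ↦ r ]) x ≡ r
  ↦-≡ ω x r = if-yes (x ≟ x) refl

  ↦-≢ : ∀ (ω : State) {x y} r → x ≢ y → (ω [ x ↦ r ]) y ≡ ω y
  ↦-≢ ω {x} {y} r x≢y = if-no (x ≟ y) x≢y

  ↦-cong : ∀ {ω ν : State} {W} x r → ω ≗ ν on W → (ω [ x ↦ r ]) ≗ (ν [ x ↦ r ]) on W
  ↦-cong {ω} {ν} x r ω≗ν {y} y∈W with x ≟ y
  ... | yes refl = trans (↦-≡ ω x r) (sym (↦-≡ ν x r))
  ... | no x≢y   = trans (↦-≢ ω r x≢y) (trans (ω≗ν y∈W) (sym (↦-≢ ν r x≢y)))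

  -- Proved together with `∂-∉vars`: at a differential the summands of unmentioned variables vanish,
  -- and they vanish because θ is constant in those variables.
  vars-coincidenceᵗ : ∀ θ I {ω ν W} → varsᵗ θ ⊆ W → ω ≗ ν on W → ⟦ θ ⟧ᵗ I ω ≡ ⟦ θ ⟧ᵗ I ν
  ∂-∉vars : ∀ θ I {ω x} → x ∉ˡ varsᵗ θ → ∂ x (⟦ θ ⟧ᵗ I) ω ≡ 0#

  vars-coincidenceᵗ (var x)   I ⊆W ω≗ν = ω≗ν (⊆W (here refl))
  vars-coincidenceᵗ (fn f θs) I ⊆W ω≗ν = cong (fnᴵ I f)
      (ext λ i → vars-coincidenceᵗ (θs i) I (concat-⊆ (λ i → varsᵗ (θs i)) ⊆W i) ω≗ν)
  vars-coincidenceᵗ (θ ⊕ η)   I ⊆W ω≗ν = cong₂ _+_ (vars-coincidenceᵗ θ I (++-⊆ˡ ⊆W) ω≗ν)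
      (vars-coincidenceᵗ η I (++-⊆ʳ (varsᵗ θ) ⊆W) ω≗ν)
  vars-coincidenceᵗ (θ ⊗ η)   I ⊆W ω≗ν = cong₂ _*_ (vars-coincidenceᵗ θ I (++-⊆ˡ ⊆W) ω≗ν)
      (vars-coincidenceᵗ η I (++-⊆ʳ (varsᵗ θ) ⊆W) ω≗ν)
  vars-coincidenceᵗ (der θ)   I {ω} {ν} {W} ⊆W ω≗ν = cong ∑ⱽ (ext summand)
    where
    summand : ∀ x → ω (x ′) * ∂ x (⟦ θ ⟧ᵗ I) ω ≡ ν (x ′) * ∂ x (⟦ θ ⟧ᵗ I) ν
    summand x with x ∈? varsᵗ θ
    ... | yes x∈ = cong₂ _*_ (ω≗ν (⊆W (∈-++⁺ʳ (varsᵗ θ) (∈-map⁺ _′ x∈)))) (cong₂ deriv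
      (ext λ r → vars-coincidenceᵗ θ I (++-⊆ˡ ⊆W) (↦-cong {W = W} x r ω≗ν)) (ω≗ν (⊆W (∈-++⁺ˡ x∈))))
    ... | no x∉ = trans (trans (cong (ω (x ′) *_) (∂-∉vars θ I x∉)) (zeroʳ _))
                        (sym (trans (cong (ν (x ′) *_) (∂-∉vars θ I x∉)) (zeroʳ _)))

  ∂-∉vars θ I {ω} {x} x∉ = deriv-const λ r → vars-coincidenceᵗ θ I {W = _∈ˡ varsᵗ θ} id λ y∈ →
    trans (↦-≢ ω r (λ { refl → x∉ y∈ })) (sym (↦-≢ ω (ω x) (λ { refl → x∉ y∈ })))

  infixl 8 _⟨_⟩

  -- Marks with index at least k keep their meaning, in accordance with `·↦`, which replaces only
  -- the first k marks.
  _⟨_⟩ : ∀ {k} → Interp → Vector ℝ k → Interp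
  _⟨_⟩ {k} I d = record { fnᴵ = fnᵈ ; prᴵ = prᴵ I ; gmᴵ = gmᴵ I ; smooth = smoothᵈ ; mono = mono I }
    where
    fnᵈ : ∀ {j} → FnSym j → Vector ℝ j → ℝ
    fnᵈ (symbol f) = fnᴵ I (symbol f)
    fnᵈ (· i) v with i ℕ.<? k
    ... | yes i<k = d (fromℕ< i<k)
    ... | no  _   = fnᴵ I (· i) v

    smoothᵈ : ∀ {j} (f : FnSym j) → Smooth (fnᵈ f)
    smoothᵈ (symbol f) = smooth I (symbol f)
    smoothᵈ (· i)   = smooth-nullary (fnᵈ (· i))

  -- A finite-dimensional chart: the point e consists of k values for the
  -- argument marks and of values for the variables in xs.
  module Chart (I : Interp) (k : ℕ) (ω : State) (xs : List Var) (xs! : Unique xs) where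
    n = List.length xs

    marks : Vector ℝ (k ℕ.+ n) → Interp
    marks e = I ⟨ (λ i → e (i ↑ˡ n)) ⟩

    state : Vector ℝ (k ℕ.+ n) → State
    state e y with y ∈? xs
    ... | yes p = e (k ↑ʳ index p)
    ... | no  _ = ω y

    state-smooth : ∀ y → Smooth (λ e → state e y)
    state-smooth y with y ∈? xs
    ... | yes p = proj-smooth (k ↑ʳ index p)
    ... | no  _ = const-smooth (ω y)

    moved : Fin n → Vector ℝ (k ℕ.+ n) → ℝ → Vector ℝ (k ℕ.+ n)
    moved i e r j = if does (j Fin.≟ k ↑ʳ i) then r else e j

    moved-≡ : ∀ i e r → moved i e r (k ↑ʳ i) ≡ r
    moved-≡ i e r = if-yes ((k ↑ʳ i) Fin.≟ (k ↑ʳ i)) refl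

    moved-≢ : ∀ i e r j → j ≢ k ↑ʳ i → moved i e r j ≡ e j
    moved-≢ i e r j j≢ = if-no (j Fin.≟ (k ↑ʳ i)) j≢

    ↑ˡ≢↑ʳ : ∀ i j → i ↑ˡ n ≢ k ↑ʳ j
    ↑ˡ≢↑ʳ i j eq with trans (sym (Fin.splitAt-↑ˡ k i n))
        (trans (cong (splitAt k) eq) (Fin.splitAt-↑ʳ k n j))
    ... | ()

    marks-moved : ∀ i e r → marks (moved i e r) ≡ marks e
    marks-moved i e r = cong (I ⟨_⟩) (ext λ j → moved-≢ i e r (j ↑ˡ n) (↑ˡ≢↑ʳ j i))

    state-lookup : ∀ e i → state e (List.lookup xs i) ≡ e (k ↑ʳ i)
    state-lookup e i with List.lookup xs i ∈? xs
    ... | yes p = cong (λ j → e (k ↑ʳ j)) (index-unique xs! i p)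
    ... | no ∉  = ⊥-elim (∉ (∈-lookup i))

    state-moved : ∀ i e r → state (moved i e r) ≡ state e [ List.lookup xs i ↦ r ]
    state-moved i e r = ext λ y → go y (List.lookup xs i ≟ y)
      where
      go : ∀ y → Dec (List.lookup xs i ≡ y) → state (moved i e r) y ≡
          (state e [ List.lookup xs i ↦ r ]) y
      go _ (yes refl) = trans (state-lookup (moved i e r) i)
          (trans (moved-≡ i e r) (sym (↦-≡ (state e) (List.lookup xs i) r)))
      go y (no ≢y) = trans unmoved (sym (↦-≢ (state e) r ≢y))
        where
        unmoved : state (moved i e r) y ≡ state e y
        unmoved with y ∈? xs
        ... | yes p = moved-≢ i e r _ λ eq → ≢y
            (sym (trans (lookup-index p) (cong (List.lookup xs) (Fin.↑ʳ-injective k _ _ eq))))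
        ... | no _  = refl

    value : Term → Vector ℝ (k ℕ.+ n) → ℝ
    value θ e = ⟦ θ ⟧ᵗ (marks e) (state e)

    -- The sum over all variables reduces to xs because the other partial derivatives vanish. On xs,
    -- updating a variable amounts to moving one coordinate of the chart, so the partial derivative
    -- is a component of the gradient.
    value-der : ∀ θ → varsᵗ θ ⊆ (_∈ˡ xs) → {G : Fin (k ℕ.+ n) → Vector ℝ (k ℕ.+ n) → ℝ} →
                (∀ e → HasGradient (value θ) e (λ i → G i e)) →
                ∀ e → value (der θ) e ≡ ∑ (λ i → state e (List.lookup xs i ′) * G (k ↑ʳ i) e)
    value-der θ θ⊆xs {G} θ′ e = trans (∑ⱽ-≡ xs! outside)
        (sum-cong-≗ λ i → cong (state e (List.lookup xs i ′) *_) (partial i))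
      where
      outside : ∀ x → x ∉ˡ xs → state e (x ′) * ∂ x (⟦ θ ⟧ᵗ (marks e)) (state e) ≡ 0#
      outside x x∉ = trans (cong (state e (x ′) *_) (∂-∉vars θ (marks e) (x∉ ∘ θ⊆xs))) (zeroʳ _)

      partial : ∀ i → ∂ (List.lookup xs i) (⟦ θ ⟧ᵗ (marks e)) (state e) ≡ G (k ↑ʳ i) e
      partial i = trans
        (cong₂ deriv (ext λ r → sym (cong₂ ⟦ θ ⟧ᵗ (marks-moved i e r) (state-moved i e r)))
          (state-lookup e i))
        (deriv-≡ (hasGradient⇒hasDeriv {F = value θ} {g = λ j → G j e} (k ↑ʳ i) (moved i e)
          (moved-≡ i e) (moved-≢ i e) (θ′ e)))

    -- For a differential, order n comes from order suc n of its argument: `value-der` exhibits it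
    -- as a finite sum of products of a coordinate with a component of the gradient.
    value-smooth : ∀ θ → varsᵗ θ ⊆ (_∈ˡ xs) → Smooth (value θ)
    value-smooth (var x) _ n = state-smooth x n
    value-smooth (fn (symbol f) θs) ⊆xs n =
      differentiable-∘ n (smooth I (symbol f) n)
          (λ i → value-smooth (θs i) (concat-⊆ (λ i → varsᵗ (θs i)) ⊆xs i) n)
    value-smooth (fn (· j) θs) _ n with j ℕ.<? k
    ... | yes j<k = proj-smooth (fromℕ< j<k ↑ˡ _) n
    ... | no  _   = subst (DifferentiableN n) (ext λ e → cong (fnᴵ I (· j)) (ext λ ()))
        (const-smooth (fnᴵ I (· j) λ ()) n)
    value-smooth (θ ⊕ η) ⊆xs n =
      differentiable-+ n (value-smooth θ (++-⊆ˡ ⊆xs) n) (value-smooth η (++-⊆ʳ (varsᵗ θ) ⊆xs) n)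
    value-smooth (θ ⊗ η) ⊆xs n =
      differentiable-* n (value-smooth θ (++-⊆ˡ ⊆xs) n) (value-smooth η (++-⊆ʳ (varsᵗ θ) ⊆xs) n)
    value-smooth (der θ) ⊆xs n with value-smooth θ (++-⊆ˡ ⊆xs) (suc n)
    ... | G , θ′ , G′ = subst (DifferentiableN n) (sym (ext (value-der θ (++-⊆ˡ ⊆xs) θ′)))
      (differentiable-∑ n λ i → differentiable-* n (state-smooth (List.lookup xs i ′) n)
        (G′ (k ↑ʳ i)))

  -- This makes the adjoint interpretation of a replaced function symbol smooth. The map factors
  -- through the chart, with projections for the marks and constants for the variables.
  marks-smooth : ∀ {k} I ω θ → Smooth {k} (λ d → ⟦ θ ⟧ᵗ (I ⟨ d ⟩) ω)
  marks-smooth {k} I ω θ n = subst (DifferentiableN n)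
      (ext λ d → cong₂ ⟦ θ ⟧ᵗ (marks-point d) (state-point d))
    (differentiable-∘ n (value-smooth θ (∈-deduplicate⁺ _≟_) n) (λ j → coordinate-smooth j n))
    where
    -- Duplicates are removed so that each variable owns exactly one coordinate of the chart.
    xs = List.deduplicate _≟_ (varsᵗ θ)
    open Chart I k ω xs (deduplicate-! (varsᵗ θ)) hiding (n)

    coordinate : Fin (k ℕ.+ List.length xs) → Vector ℝ k → ℝ
    coordinate j d = [ d , (λ i → ω (List.lookup xs i)) ] (splitAt k j)

    coordinate-smooth : ∀ j → Smooth (coordinate j)
    coordinate-smooth j with splitAt k j
    ... | inj₁ i = proj-smooth i
    ... | inj₂ i = const-smooth (ω (List.lookup xs i))

    marks-point : ∀ d → marks (λ j → coordinate j d) ≡ I ⟨ d ⟩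
    marks-point d = cong (I ⟨_⟩) (ext λ i → cong [ d , _ ] (Fin.splitAt-↑ˡ k i _))

    state-point : ∀ d → state (λ j → coordinate j d) ≡ ω
    state-point d = ext go
      where
      go : ∀ y → state (λ j → coordinate j d) y ≡ ω y
      go y with y ∈? xs
      ... | yes p = trans (cong [ d , _ ] (Fin.splitAt-↑ʳ k _ (index p)))
          (cong ω (sym (lookup-index p)))
      ... | no  _ = refl

  -- Boolean powersets and monotonicity of games.

  T-ext : ∀ {a b} → (T a → T b) → (T b → T a) → a ≡ b
  T-ext {true}  {true}  _ _ = refl
  T-ext {true}  {false} f _ = ⊥-elim (f tt)
  T-ext {false} {true}  _ g = ⊥-elim (g tt)
  T-ext {false} {false} _ _ = refl

  T-not⁺ : ∀ {a} → ¬ T a → T (not a)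
  T-not⁺ {true}  ¬a = ¬a tt
  T-not⁺ {false} _  = tt

  T-not⁻ : ∀ {a} → T (not a) → ¬ T a
  T-not⁻ {false} _ ()

  T-does⁺ : ∀ {P : Set} (d : Dec P) → P → T (does d)
  T-does⁺ (yes _) _ = tt
  T-does⁺ (no ¬p) p = ¬p p

  T-does⁻ : ∀ {P : Set} (d : Dec P) → T (does d) → P
  T-does⁻ (yes p) _ = p

  em-cong : ∀ {P Q : Set} → (P → Q) → (Q → P) → does (em {P}) ≡ does (em {Q})
  em-cong f g = T-ext (T-does⁺ em ∘ f ∘ T-does⁻ em) (T-does⁺ em ∘ g ∘ T-does⁻ em)

  ∧⁺ : ∀ {a b} → T a → T b → T (a ∧ b)
  ∧⁺ p q = Equivalence.from T-∧ (p , q)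

  ∧⁻ : ∀ {a b} → T (a ∧ b) → T a × T b
  ∧⁻ = Equivalence.to T-∧

  ⊔-⊑ : ∀ {A : Set} {X Y Z : Pow A} → X ⊑ Z → Y ⊑ Z → X ⊔ Y ⊑ Z
  ⊔-⊑ {X = X} X⊑Z Y⊑Z {a} p = [ X⊑Z , Y⊑Z ] (Equivalence.to (T-∨ {X a}) p)

  ⊑-⊔ˡ : ∀ {A : Set} {X Y : Pow A} → X ⊑ X ⊔ Y
  ⊑-⊔ˡ p = Equivalence.from T-∨ (inj₁ p)

  ⊑-⊔ʳ : ∀ {A : Set} (X : Pow A) {Y} → Y ⊑ X ⊔ Y
  ⊑-⊔ʳ X {Y} {a} p = Equivalence.from (T-∨ {X a}) (inj₂ p)

  ↓⁺ : ∀ {X ω W ν} → ν ∊ X → ν ≗ ω on W → ν ∊ (X ↓ ω ⟨ W ⟩)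
  ↓⁺ {ω = ω} {W} {ν} p q = ∧⁺ p (T-does⁺ {ν ≗ ω on W} em q)

  ↓⁻ : ∀ {X ω W ν} → ν ∊ (X ↓ ω ⟨ W ⟩) → ν ∊ X × ν ≗ ω on W
  ↓⁻ {X} {ω} {W} {ν} p with ∧⁻ {X ν} p
  ... | q , r = q , λ {x} → T-does⁻ {ν ≗ ω on W} em r {x}

  -- It makes the adjoint interpretation of a replaced game symbol monotone, and it allows
  -- postconditions to be weakened in the analysis of bound variables.
  ⟦_⟧ᵍ-mono : ∀ α I {X Y} → X ⊑ Y → ⟦ α ⟧ᵍ I X ⊑ ⟦ α ⟧ᵍ I Y
  ⟦ gm a ⟧ᵍ-mono       I X⊑Y = mono I a X⊑Y
  ⟦ x := θ ⟧ᵍ-mono     I X⊑Y = X⊑Y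
  ⟦ x ′= θ & ψ ⟧ᵍ-mono I X⊑Y p = T-does⁺ em (record
    { r = r ; 0≤r = 0≤r ; φ = φ ; start = start ; end = X⊑Y end ; slope = slope
    ; domain = domain ; constant = constant ; solution = solution })
    where open Flow (T-does⁻ em p)
  ⟦ test ψ ⟧ᵍ-mono     I X⊑Y {ω} p = let q , r = ∧⁻ {⟦ ψ ⟧ᶠ I ω} p in ∧⁺ q (X⊑Y r)
  ⟦ α ∪ᵍ β ⟧ᵍ-mono     I {X} {Y} X⊑Y {ω} p with Equivalence.to (T-∨ {⟦ α ⟧ᵍ I X ω}) p
  ... | inj₁ q = ⊑-⊔ˡ {X = ⟦ α ⟧ᵍ I Y} {⟦ β ⟧ᵍ I Y} (⟦ α ⟧ᵍ-mono I X⊑Y q)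
  ... | inj₂ q = ⊑-⊔ʳ (⟦ α ⟧ᵍ I Y) {⟦ β ⟧ᵍ I Y} (⟦ β ⟧ᵍ-mono I X⊑Y q)
  ⟦ α ⨾ β ⟧ᵍ-mono      I X⊑Y = ⟦ α ⟧ᵍ-mono I (⟦ β ⟧ᵍ-mono I X⊑Y)
  ⟦ α *ᵍ ⟧ᵍ-mono       I {X} {Y} X⊑Y p = T-does⁺ em λ Z pre → T-does⁻ em p Z
    (⊔-⊑ {X = X} {⟦ α ⟧ᵍ I Z} {Z} (λ p → pre (⊑-⊔ˡ {X = Y} {⟦ α ⟧ᵍ I Z} (X⊑Y p)))
      (λ p → pre (⊑-⊔ʳ Y {⟦ α ⟧ᵍ I Z} p)))
  ⟦ α ᵈ ⟧ᵍ-mono        I X⊑Y p = T-not⁺ λ q → T-not⁻ p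
      (⟦ α ⟧ᵍ-mono I (λ r → T-not⁺ λ s → T-not⁻ r (X⊑Y s)) q)

  -- Dependence on the interpretation of the occurring symbols.

  infix 4 _≃_on_

  -- The fields equate whole functions rather than single values, so coincidence is an equality of
  -- denotations that `cong` carries under derivatives, flows and fixpoints.
  record _≃_on_ (I J : Interp) (S : Pred Symbol 0ℓ) : Set where
    field
      fn≡ : ∀ {k} (f : FnSym k) → fn f ∈ S → fnᴵ I f ≡ fnᴵ J f
      pr≡ : ∀ {k} (p : Pr k) → pr p ∈ S → prᴵ I p ≡ prᴵ J p
      gm≡ : ∀ a → gm a ∈ S → gmᴵ I a ≡ gmᴵ J a

  open _≃_on_

  ≃-⊆ : ∀ {I J} {S S′ : Pred Symbol 0ℓ} → (∀ {s} → s ∈ S′ → s ∈ S) → I ≃ J on S → I ≃ J on S′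
  ≃-⊆ S′⊆S e = record
    { fn≡ = λ f → fn≡ e f ∘ S′⊆S ; pr≡ = λ p → pr≡ e p ∘ S′⊆S ; gm≡ = λ a → gm≡ e a ∘ S′⊆S }

  ≃-coincidenceᵗ : ∀ θ {I J} → I ≃ J on Σᵗ θ → ⟦ θ ⟧ᵗ I ≡ ⟦ θ ⟧ᵗ J
  ≃-coincidenceᵗ (var x)   e = refl
  ≃-coincidenceᵗ (fn f θs) e = ext λ ω → cong₂ (λ F v → F v) (fn≡ e f (inj₁ refl))
    (ext λ i → cong (λ F → F ω) (≃-coincidenceᵗ (θs i) (≃-⊆ (λ s → inj₂ (i , s)) e)))
  ≃-coincidenceᵗ (θ ⊕ η) e = cong₂ (λ F G ω → F ω + G ω) (≃-coincidenceᵗ θ (≃-⊆ inj₁ e))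
      (≃-coincidenceᵗ η (≃-⊆ inj₂ e))
  ≃-coincidenceᵗ (θ ⊗ η) e = cong₂ (λ F G ω → F ω * G ω) (≃-coincidenceᵗ θ (≃-⊆ inj₁ e))
      (≃-coincidenceᵗ η (≃-⊆ inj₂ e))
  ≃-coincidenceᵗ (der θ) e = cong (λ F ω → ∑ⱽ λ x → ω (x ′) * ∂ x F ω) (≃-coincidenceᵗ θ e)

  ≃-coincidenceᵍ : ∀ α {I J} → I ≃ J on Σᵍ α → ⟦ α ⟧ᵍ I ≡ ⟦ α ⟧ᵍ J
  ≃-coincidenceᶠ : ∀ φ {I J} → I ≃ J on Σᶠ φ → ⟦ φ ⟧ᶠ I ≡ ⟦ φ ⟧ᶠ J

  ≃-coincidenceᵍ (gm a)       e = gm≡ e a refl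
  ≃-coincidenceᵍ (x := θ)     e = cong (λ F X ω → X (ω [ x ↦ F ω ])) (≃-coincidenceᵗ θ e)
  ≃-coincidenceᵍ (x ′= θ & ψ) e = cong₂ (λ F Q X ω → does (em {Flow x F Q X ω}))
    (≃-coincidenceᵗ θ (≃-⊆ inj₁ e)) (≃-coincidenceᶠ ψ (≃-⊆ inj₂ e))
  ≃-coincidenceᵍ (test ψ)     e = cong _⊓_ (≃-coincidenceᶠ ψ e)
  ≃-coincidenceᵍ (α ∪ᵍ β)     e = cong₂ (λ A B X → A X ⊔ B X) (≃-coincidenceᵍ α (≃-⊆ inj₁ e))
      (≃-coincidenceᵍ β (≃-⊆ inj₂ e))
  ≃-coincidenceᵍ (α ⨾ β)      e = cong₂ (λ A B X → A (B X)) (≃-coincidenceᵍ α (≃-⊆ inj₁ e))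
      (≃-coincidenceᵍ β (≃-⊆ inj₂ e))
  ≃-coincidenceᵍ (α *ᵍ)       e = cong (λ A X ω → does (em {∀ Z → X ⊔ A Z ⊑ Z → ω ∊ Z}))
      (≃-coincidenceᵍ α e)
  ≃-coincidenceᵍ (α ᵈ)        e = cong (λ A X → complement (A (complement X))) (≃-coincidenceᵍ α e)

  ≃-coincidenceᶠ (θ ≥ᶠ η)  e = cong₂ (λ F G ω → does (em {G ω ≤ F ω}))
    (≃-coincidenceᵗ θ (≃-⊆ inj₁ e)) (≃-coincidenceᵗ η (≃-⊆ inj₂ e))
  ≃-coincidenceᶠ (pr p θs) e = ext λ ω → cong₂ (λ P v → P v) (pr≡ e p (inj₁ refl))
    (ext λ i → cong (λ F → F ω) (≃-coincidenceᵗ (θs i) (≃-⊆ (λ s → inj₂ (i , s)) e)))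
  ≃-coincidenceᶠ (¬ᶠ φ)    e = cong complement (≃-coincidenceᶠ φ e)
  ≃-coincidenceᶠ (φ ∧ᶠ ψ)  e = cong₂ _⊓_ (≃-coincidenceᶠ φ (≃-⊆ inj₁ e))
      (≃-coincidenceᶠ ψ (≃-⊆ inj₂ e))
  ≃-coincidenceᶠ (∃ᶠ x φ)  e = cong (λ P ω → does (em {∃ λ r → ω [ x ↦ r ] ∊ P}))
      (≃-coincidenceᶠ φ e)
  ≃-coincidenceᶠ (⟨ α ⟩ φ) e = cong₂ (λ A P → A P) (≃-coincidenceᵍ α (≃-⊆ inj₁ e))
      (≃-coincidenceᶠ φ (≃-⊆ inj₂ e))

  -- A game symbol contributes no variables although its interpretation may read and change all of
  -- them; the hidden symmetries account for that.
  varsᵍ : Game → List Var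
  varsᶠ : Fml → List Var

  varsᵍ (gm a)       = []
  varsᵍ (x := θ)     = x ∷ varsᵗ θ
  varsᵍ (x ′= θ & ψ) = x ∷ x ′ ∷ varsᵗ θ ++ varsᶠ ψ
  varsᵍ (test ψ)     = varsᶠ ψ
  varsᵍ (α ∪ᵍ β)     = varsᵍ α ++ varsᵍ β
  varsᵍ (α ⨾ β)      = varsᵍ α ++ varsᵍ β
  varsᵍ (α *ᵍ)       = varsᵍ α
  varsᵍ (α ᵈ)        = varsᵍ α

  varsᶠ (θ ≥ᶠ η)  = varsᵗ θ ++ varsᵗ η
  varsᶠ (pr p θs) = List.concat (List.tabulate (λ i → varsᵗ (θs i)))
  varsᶠ (¬ᶠ φ)    = varsᶠ φ
  varsᶠ (φ ∧ᶠ ψ)  = varsᶠ φ ++ varsᶠ ψ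
  varsᶠ (∃ᶠ x φ)  = x ∷ varsᶠ φ
  varsᶠ (⟨ α ⟩ φ) = varsᵍ α ++ varsᶠ φ

  -- Hidden symmetries

  -- Only game symbols can see the coordinates outside of W when W contains
  -- all variables that are mentioned; hence conjugating their interpretation
  -- by τ conjugates the semantics of every game and formula.
  record HiddenSymmetry (W : Pred Var 0ℓ) : Set where
    field
      τ          : State → State
      involutive : ∀ ω → τ (τ ω) ≡ ω
      fixes      : ∀ ω → τ ω ≗ ω on W
      permutes   : ∀ {ω ν} → ω ≗ ν on ∁ W → τ ω ≗ τ ν on ∁ W

    -- Inside W both images keep the old values, and outside of W `permutes` applies. This carries
    -- the frame conditions of updates and flows across τ.
    τ-local : ∀ {V : Pred Var 0ℓ} {ω ν} → (∀ {x} → x ∈ V → x ∈ W) → ω ≗ ν on ∁ V → τ ω ≗ τ ν on ∁ V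
    τ-local {V} {ω} {ν} V⊆W ω≗ν {y} y∉V with em {y ∈ W}
    ... | yes y∈W = trans (fixes ω y∈W) (trans (ω≗ν y∉V) (sym (fixes ν y∈W)))
    ... | no  y∉W = permutes (λ {z} z∉W → ω≗ν (z∉W ∘ V⊆W)) y∉W

    τ-↦ : ∀ ω {x} r → x ∈ W → τ (ω [ x ↦ r ]) ≡ τ ω [ x ↦ r ]
    τ-↦ ω {x} r x∈W = ext λ y → go y (x ≟ y)
      where
      go : ∀ y → Dec (x ≡ y) → τ (ω [ x ↦ r ]) y ≡ (τ ω [ x ↦ r ]) y
      go _ (yes refl) = trans (fixes _ x∈W) (trans (↦-≡ ω x r) (sym (↦-≡ (τ ω) x r)))
      go y (no x≢y)   = trans (τ-local {V = ｛ x ｝} (λ { refl → x∈W }) (λ x≢z → ↦-≢ ω r x≢z) x≢y)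
          (sym (↦-≢ (τ ω) r x≢y))

    conj : Interp → Interp
    conj I = record
      { fnᴵ = fnᴵ I ; prᴵ = prᴵ I ; gmᴵ = λ a X → gmᴵ I a (X ∘ τ) ∘ τ ; smooth = smooth I
      ; mono = λ a X⊑Y → mono I a X⊑Y }

    ∘τ∘τ : ∀ {A : Set} (X : State → A) → X ∘ τ ∘ τ ≡ X
    ∘τ∘τ X = ext λ ω → cong X (involutive ω)

    -- Applying τ pointwise leaves the curves of x and x′ unchanged, hence also the differential
    -- equation, and `τ-local` preserves constancy elsewhere. The data are related by equations so
    -- that the lemma serves both directions in `conjᵍ`.
    flow-τ : ∀ {x F Q X F′ Q′ X′ ω} → x ∈ W → x ′ ∈ W → F ≡ F′ ∘ τ → Q ≡ Q′ ∘ τ → X ≡ X′ ∘ τ →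
             Flow x F Q X ω → Flow x F′ Q′ X′ (τ ω)
    flow-τ {x} {ω = ω} x∈W x′∈W refl refl refl flow = record
      { r = r ; 0≤r = 0≤r ; φ = τ ∘ φ
      ; start    = τ-local {V = ｛ x ′ ｝} {φ 0#} {ω} (λ { refl → x′∈W }) start
      ; end      = end
      ; slope    = λ ζ ζ∈ → trans (fixes (φ ζ) x′∈W) (slope ζ ζ∈)
      ; domain   = domain
      ; constant = λ ζ ζ∈ → τ-local {V = ｛ x ｝ ∪ ｛ x ′ ｝} {φ ζ} {φ 0#}
          (λ { (inj₁ refl) → x∈W ; (inj₂ refl) → x′∈W }) (constant ζ ζ∈)
      ; solution = λ ζ ζ∈ 0<r → subst₂ (λ f d → HasDerivWithin Interval f ζ d)
                     (ext λ t → sym (fixes (φ t) x∈W)) (sym (fixes (φ ζ) x′∈W)) (solution ζ ζ∈ 0<r)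
      }
      where open Flow flow

    module _ (I : Interp) where
      conjᵗ : ∀ θ → varsᵗ θ ⊆ W → ⟦ θ ⟧ᵗ (conj I) ≡ ⟦ θ ⟧ᵗ I ∘ τ
      conjᵗ θ ⊆W = ext λ ω → trans (fns ω)
          (vars-coincidenceᵗ θ I {W = W} ⊆W (λ x∈W → sym (fixes ω x∈W)))
        where
        -- Terms contain no game symbols, and `conj` changes nothing else.
        same : ∀ θ → ⟦ θ ⟧ᵗ (conj I) ≡ ⟦ θ ⟧ᵗ I
        same (var x)   = refl
        same (fn f θs) = ext λ ω → cong (fnᴵ I f) (ext λ i → cong (λ F → F ω) (same (θs i)))
        same (θ ⊕ η)   = cong₂ (λ F G ω → F ω + G ω) (same θ) (same η)
        same (θ ⊗ η)   = cong₂ (λ F G ω → F ω * G ω) (same θ) (same η)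
        same (der θ)   = cong (λ F ω → ∑ⱽ λ x → ω (x ′) * ∂ x F ω) (same θ)
        fns : ∀ ω → ⟦ θ ⟧ᵗ (conj I) ω ≡ ⟦ θ ⟧ᵗ I ω
        fns ω = cong (λ F → F ω) (same θ)

      conjᵍ : ∀ α → varsᵍ α ⊆ W → ∀ X → ⟦ α ⟧ᵍ (conj I) X ≡ ⟦ α ⟧ᵍ I (X ∘ τ) ∘ τ
      conjᶠ : ∀ φ → varsᶠ φ ⊆ W → ⟦ φ ⟧ᶠ (conj I) ≡ ⟦ φ ⟧ᶠ I ∘ τ

      conjᵍ (gm a)       ⊆W X = refl
      conjᵍ (x := θ)     ⊆W X = ext λ ω → cong X (begin
        ω [ x ↦ ⟦ θ ⟧ᵗ (conj I) ω ]
          ≡⟨ cong₂ (λ ν r → ν [ x ↦ r ]) (sym (involutive ω))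
            (cong (λ F → F ω) (conjᵗ θ (⊆W ∘ there))) ⟩
        τ (τ ω) [ x ↦ ⟦ θ ⟧ᵗ I (τ ω) ]           ≡⟨ sym (τ-↦ (τ ω) _ (⊆W (here refl))) ⟩
        τ (τ ω [ x ↦ ⟦ θ ⟧ᵗ I (τ ω) ])           ∎)
      conjᵍ (x ′= θ & ψ) ⊆W X = ext λ ω → em-cong
        (flow-τ x∈W x′∈W eqᵗ eqᶠ (sym (∘τ∘τ X)))
        (λ flow → subst (Flow _ _ _ _) (involutive ω)
          (flow-τ x∈W x′∈W (flip eqᵗ) (flip eqᶠ) refl flow))
        where
        x∈W  = ⊆W (here refl)
        x′∈W = ⊆W (there (here refl))
        eqᵗ = conjᵗ θ (++-⊆ˡ (⊆W ∘ there ∘ there))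
        eqᶠ = conjᶠ ψ (++-⊆ʳ (varsᵗ θ) (⊆W ∘ there ∘ there))
        flip : ∀ {A : Set} {F G : State → A} → F ≡ G ∘ τ → G ≡ F ∘ τ
        flip {G = G} refl = sym (∘τ∘τ G)
      conjᵍ (test ψ)     ⊆W X = cong₂ _⊓_ (conjᶠ ψ ⊆W) (sym (∘τ∘τ X))
      conjᵍ (α ∪ᵍ β)     ⊆W X = cong₂ _⊔_ (conjᵍ α (++-⊆ˡ ⊆W) X) (conjᵍ β (++-⊆ʳ (varsᵍ α) ⊆W) X)
      conjᵍ (α ⨾ β)      ⊆W X = begin
        ⟦ α ⟧ᵍ (conj I) (⟦ β ⟧ᵍ (conj I) X)
          ≡⟨ cong (⟦ α ⟧ᵍ (conj I)) (conjᵍ β (++-⊆ʳ (varsᵍ α) ⊆W) X) ⟩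
        ⟦ α ⟧ᵍ (conj I) (⟦ β ⟧ᵍ I (X ∘ τ) ∘ τ)     ≡⟨ conjᵍ α (++-⊆ˡ ⊆W) _ ⟩
        ⟦ α ⟧ᵍ I (⟦ β ⟧ᵍ I (X ∘ τ) ∘ τ ∘ τ) ∘ τ    ≡⟨ cong (λ Y → ⟦ α ⟧ᵍ I Y ∘ τ) (∘τ∘τ _) ⟩
        ⟦ α ⟧ᵍ I (⟦ β ⟧ᵍ I (X ∘ τ)) ∘ τ            ∎
      -- The pre-fixpoints of the two loops correspond under composition with τ.
      conjᵍ (α *ᵍ)       ⊆W X = ext λ ω → em-cong
        (λ least Z pre → least (Z ∘ τ) (⊔-⊑ {X = X}
          (λ {s} p → pre (⊑-⊔ˡ {X = X ∘ τ} {⟦ α ⟧ᵍ I Z} {τ s}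
            (subst (λ s → s ∊ X) (sym (involutive s)) p)))
          (λ {s} p → pre (⊑-⊔ʳ (X ∘ τ) {⟦ α ⟧ᵍ I Z} {τ s} (subst (λ Y → τ s ∊ ⟦ α ⟧ᵍ I Y) (∘τ∘τ Z)
                     (subst (λ Y → s ∊ Y) (conjᵍ α ⊆W (Z ∘ τ)) p))))))
        (λ least Z pre → subst (λ s → s ∊ Z) (involutive ω) (least (Z ∘ τ) (⊔-⊑ {X = X ∘ τ}
          (λ {s} p → pre (⊑-⊔ˡ {X = X} {⟦ α ⟧ᵍ (conj I) Z} {τ s} p))
          (λ {s} p → pre (⊑-⊔ʳ X {⟦ α ⟧ᵍ (conj I) Z} {τ s}
            (subst (λ Y → τ s ∊ Y) (sym (conjᵍ α ⊆W Z))
                     (subst (λ s → s ∊ ⟦ α ⟧ᵍ I (Z ∘ τ)) (sym (involutive s)) p)))))))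
      conjᵍ (α ᵈ)        ⊆W X = cong complement (conjᵍ α ⊆W (complement X))

      conjᶠ (θ ≥ᶠ η)  ⊆W = cong₂ (λ F G ω → does (em {G ω ≤ F ω})) (conjᵗ θ (++-⊆ˡ ⊆W))
          (conjᵗ η (++-⊆ʳ (varsᵗ θ) ⊆W))
      conjᶠ (pr p θs) ⊆W = ext λ ω → cong (prᴵ I p) (ext λ i →
        cong (λ F → F ω) (conjᵗ (θs i) (concat-⊆ (λ i → varsᵗ (θs i)) ⊆W i)))
      conjᶠ (¬ᶠ φ)    ⊆W = cong complement (conjᶠ φ ⊆W)
      conjᶠ (φ ∧ᶠ ψ)  ⊆W = cong₂ _⊓_ (conjᶠ φ (++-⊆ˡ ⊆W)) (conjᶠ ψ (++-⊆ʳ (varsᶠ φ) ⊆W))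
      conjᶠ (∃ᶠ x φ)  ⊆W = ext λ ω → cong (λ P → does (em {∃ λ r → T (P r)})) (ext λ r →
        trans (cong (λ P → P (ω [ x ↦ r ])) (conjᶠ φ (⊆W ∘ there)))
            (cong (⟦ φ ⟧ᶠ I) (τ-↦ ω r (⊆W (here refl)))))
      conjᶠ (⟨ α ⟩ φ) ⊆W = begin
        ⟦ α ⟧ᵍ (conj I) (⟦ φ ⟧ᶠ (conj I))   ≡⟨ conjᵍ α (++-⊆ˡ ⊆W) _ ⟩
        ⟦ α ⟧ᵍ I (⟦ φ ⟧ᶠ (conj I) ∘ τ) ∘ τ
          ≡⟨ cong (λ P → ⟦ α ⟧ᵍ I (P ∘ τ) ∘ τ) (conjᶠ φ (++-⊆ʳ (varsᵍ α) ⊆W)) ⟩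
        ⟦ α ⟧ᵍ I (⟦ φ ⟧ᶠ I ∘ τ ∘ τ) ∘ τ     ≡⟨ cong (λ P → ⟦ α ⟧ᵍ I P ∘ τ) (∘τ∘τ _) ⟩
        ⟦ α ⟧ᵍ I (⟦ φ ⟧ᶠ I) ∘ τ             ∎

  module Transposition (W : Pred Var 0ℓ) (μ ν : State) where
    splice : State → State → State
    splice s t y = if does (em {y ∈ W}) then s y else t y

    splice-∈ : ∀ s t → splice s t ≗ s on W
    splice-∈ s t y∈W = if-yes em y∈W

    splice-∉ : ∀ s t → splice s t ≗ t on ∁ W
    splice-∉ s t y∉W = if-no em y∉W

    splice-≡ : ∀ {s t u} → u ≗ s on W → u ≗ t on ∁ W → splice s t ≡ u
    splice-≡ {s} {t} {u} on off = ext go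
      where
      go : ∀ y → splice s t y ≡ u y
      go y with em {y ∈ W}
      ... | yes y∈W = sym (on y∈W)
      ... | no  y∉W = sym (off y∉W)

    -- Swaps the projections of μ and ν to ∁ W, keeping the part on W and every other projection.
    exchange : State → State
    exchange s with em {s ≗ μ on ∁ W} | em {s ≗ ν on ∁ W}
    ... | yes _ | _     = splice s ν
    ... | no _  | yes _ = splice s μ
    ... | no _  | no _  = s

    exchange-μ : ∀ {s} → s ≗ μ on ∁ W → exchange s ≡ splice s ν
    exchange-μ {s} s~μ with em {s ≗ μ on ∁ W} | em {s ≗ ν on ∁ W}
    ... | yes _   | _ = refl
    ... | no ¬s~μ | _ = ⊥-elim (¬s~μ s~μ)

    exchange-ν : ∀ {s} → s ≗ ν on ∁ W → exchange s ≡ splice s μ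
    exchange-ν {s} s~ν with em {s ≗ μ on ∁ W} | em {s ≗ ν on ∁ W}
    -- Here μ and ν agree outside of W, so both splices are the same state.
    ... | yes s~μ | _ = splice-≡ (splice-∈ s μ)
        (λ y∉W → trans (splice-∉ s μ y∉W) (trans (sym (s~μ y∉W)) (s~ν y∉W)))
    ... | no _ | yes _   = refl
    ... | no _ | no ¬s~ν = ⊥-elim (¬s~ν s~ν)

    exchange-other : ∀ {s} → ¬ (s ≗ μ on ∁ W) → ¬ (s ≗ ν on ∁ W) → exchange s ≡ s
    exchange-other {s} ¬s~μ ¬s~ν with em {s ≗ μ on ∁ W} | em {s ≗ ν on ∁ W}
    ... | yes s~μ | _       = ⊥-elim (¬s~μ s~μ)
    ... | no _    | yes s~ν = ⊥-elim (¬s~ν s~ν)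
    ... | no _    | no _    = refl

    symmetry : HiddenSymmetry W
    symmetry = record
      { τ = exchange ; involutive = involutive ; fixes = fixes ; permutes = permutes }
      where
      back : ∀ {s t u} → s ≗ u on ∁ W → splice (splice s t) u ≡ s
      back {s} {t} s~u = splice-≡ (λ y∈W → sym (splice-∈ s t y∈W)) s~u

      involutive : ∀ s → exchange (exchange s) ≡ s
      involutive s with em {s ≗ μ on ∁ W} | em {s ≗ ν on ∁ W}
      ... | yes s~μ | _       = trans (exchange-ν (splice-∉ s ν)) (back s~μ)
      ... | no _    | yes s~ν = trans (exchange-μ (splice-∉ s μ)) (back s~ν)
      ... | no ¬s~μ | no ¬s~ν = exchange-other ¬s~μ ¬s~ν

      fixes : ∀ s → exchange s ≗ s on W
      fixes s y∈W with em {s ≗ μ on ∁ W} | em {s ≗ ν on ∁ W}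
      ... | yes _ | _     = splice-∈ s ν y∈W
      ... | no _  | yes _ = splice-∈ s μ y∈W
      ... | no _  | no _  = refl

      permutes : ∀ {s t} → s ≗ t on ∁ W → exchange s ≗ exchange t on ∁ W
      permutes {s} {t} s~t {y} y∉W with em {s ≗ μ on ∁ W} | em {s ≗ ν on ∁ W}
      ... | yes s~μ | _ = trans (splice-∉ s ν y∉W) (sym (trans (cong (λ f → f y)
              (exchange-μ {t} (λ z∉W → trans (sym (s~t z∉W)) (s~μ z∉W)))) (splice-∉ t ν y∉W)))
      ... | no _ | yes s~ν = trans (splice-∉ s μ y∉W) (sym (trans (cong (λ f → f y)
              (exchange-ν {t} (λ z∉W → trans (sym (s~t z∉W)) (s~ν z∉W)))) (splice-∉ t μ y∉W)))
      ... | no ¬s~μ | no ¬s~ν = trans (s~t y∉W) (sym (cong (λ f → f y) (exchange-other {t}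
              (λ t~μ → ¬s~μ λ z∉W → trans (s~t z∉W) (t~μ z∉W))
                (λ t~ν → ¬s~ν λ z∉W → trans (s~t z∉W) (t~ν z∉W)))))

  ≢-suc : ∀ r → r + 1# ≢ r
  ≢-suc r eq = 0≢1 (sym (trans (sym (x+y-x≡y r 1#)) (trans (cong (_- r) eq) (x-x≡0 r))))

  module Flip {W : Pred Var 0ℓ} {x : Var} (x∉W : x ∉ W) (ω : State) where
    Near : State → Set
    Near s = ∀ {y} → y ∉ W → x ≢ y → s y ≡ ω y

    swap : ℝ → ℝ
    swap r with em {r ≡ ω x} | em {r ≡ ω x + 1#}
    ... | yes _ | _     = ω x + 1#
    ... | no _  | yes _ = ω x
    ... | no _  | no _  = r

    swap-ω : swap (ω x) ≡ ω x + 1#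
    swap-ω with em {ω x ≡ ω x} | em {ω x ≡ ω x + 1#}
    ... | yes _ | _ = refl
    ... | no ¬p | _ = ⊥-elim (¬p refl)

    swap-ω+1 : swap (ω x + 1#) ≡ ω x
    swap-ω+1 with em {ω x + 1# ≡ ω x} | em {ω x + 1# ≡ ω x + 1#}
    ... | yes p | _     = p
    ... | no _  | yes _ = refl
    ... | no _  | no ¬p = ⊥-elim (¬p refl)

    swap-other : ∀ {r} → r ≢ ω x → r ≢ ω x + 1# → swap r ≡ r
    swap-other {r} p q with em {r ≡ ω x} | em {r ≡ ω x + 1#}
    ... | yes p′ | _      = ⊥-elim (p p′)
    ... | no _   | yes q′ = ⊥-elim (q q′)
    ... | no _   | no _   = refl

    swap-involutive : ∀ r → swap (swap r) ≡ r
    swap-involutive r with em {r ≡ ω x} | em {r ≡ ω x + 1#}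
    ... | yes p | _     = trans swap-ω+1 (sym p)
    ... | no _  | yes q = trans swap-ω (sym q)
    ... | no p  | no q  = swap-other p q

    -- On states that are not near, the values ω x and ω x + 1 of x trade places. Nearness does not
    -- look at x, so flipping preserves it, which makes `flip` an involution.
    flip : State → State
    flip s with em {Near s}
    ... | yes _ = s
    ... | no  _ = s [ x ↦ swap (s x) ]

    flip-near : ∀ {s} → Near s → flip s ≡ s
    flip-near {s} p with em {Near s}
    ... | yes _ = refl
    ... | no ¬p = ⊥-elim (¬p p)

    flip-far : ∀ {s} → ¬ Near s → flip s ≡ s [ x ↦ swap (s x) ]
    flip-far {s} ¬p with em {Near s}
    ... | yes p = ⊥-elim (¬p p)
    ... | no _  = refl

    ↦-↦ : ∀ (s : State) q {r} → r ≡ s x → s [ x ↦ q ] [ x ↦ r ] ≡ s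
    ↦-↦ s q {r} r≡sx = ext λ y → go y (x ≟ y)
      where
      go : ∀ y → Dec (x ≡ y) → (s [ x ↦ q ] [ x ↦ r ]) y ≡ s y
      go _ (yes refl) = trans (↦-≡ (s [ x ↦ q ]) x r) r≡sx
      go y (no x≢y)   = trans (↦-≢ (s [ x ↦ q ]) r x≢y) (↦-≢ s q x≢y)

    symmetry : HiddenSymmetry W
    symmetry = record { τ = flip ; involutive = involutive ; fixes = fixes ; permutes = permutes }
      where
      involutive : ∀ s → flip (flip s) ≡ s
      involutive s with em {Near s}
      ... | yes p = flip-near p
      ... | no ¬p = trans (flip-far λ p → ¬p λ y∉W x≢y → trans (sym (↦-≢ s _ x≢y)) (p y∉W x≢y))
                          (↦-↦ s _ (trans (cong swap (↦-≡ s x _)) (swap-involutive (s x))))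

      fixes : ∀ s → flip s ≗ s on W
      fixes s y∈W with em {Near s}
      ... | yes _ = refl
      ... | no  _ = ↦-≢ s _ λ { refl → x∉W y∈W }

      permutes : ∀ {s t} → s ≗ t on ∁ W → flip s ≗ flip t on ∁ W
      permutes {s} {t} s~t {y} y∉W with em {Near s}
      ... | yes p = trans (s~t y∉W) (sym (cong (λ f → f y)
              (flip-near {t} λ z∉W x≢z → trans (sym (s~t z∉W)) (p z∉W x≢z))))
      ... | no ¬p = trans (↦-cong {W = ∁ W} x (swap (s x)) s~t y∉W)
              (sym (cong (λ f → f y)
                (trans (flip-far {t} λ p → ¬p λ z∉W x≢z → trans (s~t z∉W) (p z∉W x≢z))
                (cong (λ r → t [ x ↦ swap r ]) (sym (s~t x∉W))))))

    near-ω : Near ω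
    near-ω _ _ = refl

    -- If s were not near, `flip` would move its value ω x at x to ω x + 1. So s is near, and at x
    -- the agreement is assumed.
    flip-slice : ∀ {s} → s x ≡ ω x → flip s x ≡ ω x → s ≗ ω on ∁ W
    flip-slice {s} sx≡ωx flipsx≡ωx {y} y∉W with em {Near s} | x ≟ y
    ... | yes _ | yes refl = sx≡ωx
    ... | yes p | no x≢y   = p y∉W x≢y
    ... | no ¬p | _        = ⊥-elim (≢-suc (ω x) (begin
      ω x + 1#                       ≡⟨ sym swap-ω ⟩
      swap (ω x)                     ≡⟨ cong swap (sym sx≡ωx) ⟩
      swap (s x)                     ≡⟨ sym (↦-≡ s x _) ⟩
      (s [ x ↦ swap (s x) ]) x       ≡⟨ flipsx≡ωx ⟩
      ω x                            ∎))

  -- Coincidence and bound effect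

  -- Changes of single variables suffice for finitely many coordinates. The last component of the
  -- result controls the coordinates that are not listed.
  move-coordinates : ∀ (P : State → Set) {ω} ν ys →
    (∀ {y} → y ∈ˡ ys → ω y ≡ ν y ⊎ (∀ s r → P s → P (s [ y ↦ r ]))) → P ω →
    ∃ λ s → P s × s ≗ ν on (_∈ˡ ys) × (∀ y → s y ≡ ω y ⊎ s y ≡ ν y)
  move-coordinates P {ω} ν []       step Pω = ω , Pω , (λ ()) , λ _ → inj₁ refl
  move-coordinates P {ω} ν (y ∷ ys) step Pω with move-coordinates P ν ys (step ∘ there) Pω
  ... | s , Ps , s≗ν , between with step (here refl)
  ... | inj₁ ωy≡νy = s , Ps , agree , between
    where
    agree : s ≗ ν on (_∈ˡ y ∷ ys)
    -- Nothing was moved at y: its value comes from ω or ν, which agree there.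
    agree (here refl) = [ (λ eq → trans eq ωy≡νy) , id ] (between y)
    agree (there p)   = s≗ν p
  ... | inj₂ move = s [ y ↦ ν y ] , move s (ν y) Ps , agree , λ z → between′ z (y ≟ z)
    where
    between′ : ∀ z → Dec (y ≡ z) → (s [ y ↦ ν y ]) z ≡ ω z ⊎ (s [ y ↦ ν y ]) z ≡ ν z
    between′ _ (yes refl) = inj₂ (↦-≡ s y (ν y))
    between′ z (no y≢z) rewrite ↦-≢ s (ν y) y≢z = between z

    agree : (s [ y ↦ ν y ]) ≗ ν on (_∈ˡ y ∷ ys)
    agree (here refl) = ↦-≡ s y (ν y)
    agree {z} (there p) with y ≟ z
    ... | yes refl = ↦-≡ s y (ν y)
    ... | no y≢z   = trans (↦-≢ s (ν y) y≢z) (s≗ν p)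

  -- Terms depend on finitely many variables, so moving along `varsᵗ θ` one variable at a time is
  -- enough.
  FV-coincidenceᵗ : ∀ θ I {ω ν} → ω ≗ ν on FVᵗ θ → ⟦ θ ⟧ᵗ I ω ≡ ⟦ θ ⟧ᵗ I ν
  FV-coincidenceᵗ θ I {ω} {ν} ω≗ν =
    let s , eq , s≗ν , _ = move-coordinates (λ s → ⟦ θ ⟧ᵗ I ω ≡ ⟦ θ ⟧ᵗ I s) ν (varsᵗ θ)
                             (λ {y} _ → step y) refl
    in trans eq (vars-coincidenceᵗ θ I {W = _∈ˡ varsᵗ θ} id s≗ν)
    where
    step : ∀ y → ω y ≡ ν y ⊎ (∀ s r → ⟦ θ ⟧ᵗ I ω ≡ ⟦ θ ⟧ᵗ I s → ⟦ θ ⟧ᵗ I ω ≡ ⟦ θ ⟧ᵗ I (s [ y ↦ r ]))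
    step y with em {y ∈ FVᵗ θ}
    ... | yes y∈FV = inj₁ (ω≗ν y∈FV)
    ... | no  y∉FV = inj₂ λ s r eq → trans eq (free s r)
      where
      free : ∀ s r → ⟦ θ ⟧ᵗ I s ≡ ⟦ θ ⟧ᵗ I (s [ y ↦ r ])
      free s r with em {⟦ θ ⟧ᵗ I s ≡ ⟦ θ ⟧ᵗ I (s [ y ↦ r ])}
      ... | yes eq = eq
      ... | no ≢   = ⊥-elim (y∉FV (I , s , s [ y ↦ r ] , (λ y≢z → sym (↦-≢ s r y≢z)) , ≢))

  ∉FVᶠ : ∀ {φ x} → x ∉ FVᶠ φ → ∀ I s r → s ∊ ⟦ φ ⟧ᶠ I → s [ x ↦ r ] ∊ ⟦ φ ⟧ᶠ I
  ∉FVᶠ {φ} {x} x∉FV I s r p with T? (⟦ φ ⟧ᶠ I (s [ x ↦ r ]))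
  ... | yes q = q
  ... | no ¬q = ⊥-elim (x∉FV (I , s , s [ x ↦ r ] , (λ x≢y → sym (↦-≢ s r x≢y)) , p , ¬q))

  -- A change of the projection to ∁ W is conjugate to a change of x alone.
  ∉FVᶠ-tail : ∀ {φ W x} → varsᶠ φ ⊆ W → x ∉ W → x ∉ FVᶠ φ →
              ∀ I {ω ν} → ω ≗ ν on W → ω ∊ ⟦ φ ⟧ᶠ I → ν ∊ ⟦ φ ⟧ᶠ I
  ∉FVᶠ-tail {φ} {W} {x} ⊆W x∉W x∉FV I {ω} {ν} ω≗ν p with em {ω ≗ ν on ∁ W}
  ... | yes off = subst (_∊ ⟦ φ ⟧ᶠ I) (ext λ y → agree y) p
    where
    agree : ∀ y → ω y ≡ ν y
    agree y with em {y ∈ W}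
    ... | yes y∈W = ω≗ν y∈W
    ... | no  y∉W = off y∉W
  ... | no ¬off = subst (_∊ ⟦ φ ⟧ᶠ I) τμ≡ν
                    (subst (μ ∊_) (conjᶠ I φ ⊆W) (∉FVᶠ {φ} x∉FV (conj I) ω (ω x + 1#)
                      (subst (ω ∊_) (sym (conjᶠ I φ ⊆W)) (subst (_∊ ⟦ φ ⟧ᶠ I) (sym τω≡ω) p))))
    where
    -- Since x is not free, truth passes from ω to μ in `conj I`. The exchange fixes ω, which agrees
    -- outside of W with neither μ nor ν, and it takes μ to ν.
    μ = ω [ x ↦ ω x + 1# ]
    open Transposition W μ ν
    open HiddenSymmetry symmetry

    ¬ω≗μ : ¬ (ω ≗ μ on ∁ W)
    ¬ω≗μ ω≗μ = ≢-suc (ω x) (sym (trans (ω≗μ x∉W) (↦-≡ ω x _)))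

    τω≡ω : τ ω ≡ ω
    τω≡ω = exchange-other ¬ω≗μ ¬off

    τμ≡ν : τ μ ≡ ν
    τμ≡ν = trans (exchange-μ {μ} (λ _ → refl))
      (splice-≡ (λ y∈W → trans (sym (ω≗ν y∈W)) (sym (↦-≢ ω _ λ { refl → x∉W y∈W }))) (λ _ → refl))

  -- First the mentioned variables are moved to ν. If some unmentioned variable is not free,
  -- `∉FVᶠ-tail` changes all the others jointly; otherwise every unmentioned variable is free, and
  -- there ω and ν agree.
  FV-coincidenceᶠ-⊑ : ∀ φ I {ω ν} → ω ≗ ν on FVᶠ φ → ω ∊ ⟦ φ ⟧ᶠ I → ν ∊ ⟦ φ ⟧ᶠ I
  FV-coincidenceᶠ-⊑ φ I {ω} {ν} ω≗ν p
    with move-coordinates (_∊ ⟦ φ ⟧ᶠ I) ν (varsᶠ φ) (λ {y} _ → step y) p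
       | em {∃ λ x → x ∉ˡ varsᶠ φ × x ∉ FVᶠ φ}
    where
    step : ∀ y → ω y ≡ ν y ⊎ (∀ s r → s ∊ ⟦ φ ⟧ᶠ I → s [ y ↦ r ] ∊ ⟦ φ ⟧ᶠ I)
    step y with em {y ∈ FVᶠ φ}
    ... | yes y∈FV = inj₁ (ω≗ν y∈FV)
    ... | no  y∉FV = inj₂ (∉FVᶠ {φ} y∉FV I)
  ... | s , q , s≗ν , _ | yes (x , x∉vars , x∉FV) =
      ∉FVᶠ-tail {φ} {_∈ˡ varsᶠ φ} id x∉vars x∉FV I s≗ν q
  ... | s , q , s≗ν , between | no ¬∃ = subst (_∊ ⟦ φ ⟧ᶠ I) (ext agree) q
    where
    agree : ∀ y → s y ≡ ν y
    agree y with y ∈? varsᶠ φ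
    ... | yes y∈ = s≗ν y∈
    ... | no y∉ with em {y ∈ FVᶠ φ}
    ... | yes y∈FV = [ (λ eq → trans eq (ω≗ν y∈FV)) , id ] (between y)
    ... | no  y∉FV = ⊥-elim (¬∃ (y , y∉ , y∉FV))

  FV-coincidenceᶠ : ∀ φ I {ω ν} → ω ≗ ν on FVᶠ φ → ⟦ φ ⟧ᶠ I ω ≡ ⟦ φ ⟧ᶠ I ν
  FV-coincidenceᶠ φ I {ω} {ν} ω≗ν = T-ext (FV-coincidenceᶠ-⊑ φ I ω≗ν)
      (FV-coincidenceᶠ-⊑ φ I {ν} {ω} (λ x∈FV → sym (ω≗ν x∈FV)))

  ∉BV : ∀ {α x} → x ∉ BV α → ∀ I {ω X} → ω ∊ ⟦ α ⟧ᵍ I X → ω ∊ ⟦ α ⟧ᵍ I (X ↓ ω ⟨ ｛ x ｝ ⟩)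
  ∉BV {α} {x} x∉BV I {ω} {X} p with T? (⟦ α ⟧ᵍ I (X ↓ ω ⟨ ｛ x ｝ ⟩) ω)
  ... | yes q = q
  ... | no ¬q = ⊥-elim (x∉BV (I , ω , X , p , ¬q))

  -- The slice { s ∣ s x = ω x } and its image under a symmetry fixing ω
  -- meet only in the states with the same projection to ∁ W as ω.
  ∉BV-tail : ∀ {α W x} → varsᵍ α ⊆ W → x ∉ W → x ∉ BV α →
             ∀ I {ω X} → ω ∊ ⟦ α ⟧ᵍ I X → ω ∊ ⟦ α ⟧ᵍ I (X ↓ ω ⟨ ∁ W ⟩)
  ∉BV-tail {α} {W} {x} ⊆W x∉W x∉BV I {ω} {X} p = ⟦ α ⟧ᵍ-mono I inclusion unconjugated
    where
    open Flip {W} x∉W ω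
    open HiddenSymmetry symmetry

    -- That x is not bound is used twice, in `I` and then in `conj I`; each use cuts the
    -- postcondition down to a slice.
    X₁ X₂ : Pow State
    X₁ = X ↓ ω ⟨ ｛ x ｝ ⟩
    X₂ = (X₁ ∘ τ) ↓ ω ⟨ ｛ x ｝ ⟩

    τω≡ω : τ ω ≡ ω
    τω≡ω = flip-near near-ω

    conjugated : ω ∊ ⟦ α ⟧ᵍ (conj I) (X₁ ∘ τ)
    conjugated = subst (ω ∊_) (sym (conjᵍ I α ⊆W (X₁ ∘ τ)))
      (subst₂ (λ Y s → s ∊ ⟦ α ⟧ᵍ I Y) (sym (∘τ∘τ X₁)) (sym τω≡ω) (∉BV {α} x∉BV I p))

    unconjugated : ω ∊ ⟦ α ⟧ᵍ I (X₂ ∘ τ)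
    unconjugated = subst (_∊ ⟦ α ⟧ᵍ I (X₂ ∘ τ)) τω≡ω
      (subst (ω ∊_) (conjᵍ I α ⊆W X₂) (∉BV {α} x∉BV (conj I) conjugated))

    inclusion : X₂ ∘ τ ⊑ X ↓ ω ⟨ ∁ W ⟩
    inclusion {s} q with ↓⁻ {X₁ ∘ τ} {ω} {｛ x ｝} {τ s} q
    ... | q₁ , τsx≡ωx with ↓⁻ {X} {ω} {｛ x ｝} {s} (subst (_∊ X₁) (involutive s) q₁)
    ... | s∈X , sx≡ωx = ↓⁺ {X} {ω} {∁ W} {s} s∈X (flip-slice {s} (sx≡ωx refl) (τsx≡ωx refl))

  restrict-∉BV : ∀ α I {ω} ys {X} → ω ∊ ⟦ α ⟧ᵍ I X →
                 ω ∊ ⟦ α ⟧ᵍ I (X ↓ ω ⟨ (λ y → y ∈ˡ ys × y ∉ BV α) ⟩)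
  restrict-∉BV α I {ω} [] {X} = ⟦ α ⟧ᵍ-mono I λ {s} p → ↓⁺ {X} {ω} {_} {s} p λ { (() , _) }
  restrict-∉BV α I {ω} (y ∷ ys) {X} p with em {y ∈ BV α}
  ... | yes y∈BV = ⟦ α ⟧ᵍ-mono I inclusion (restrict-∉BV α I ys p)
    where
    inclusion : X ↓ ω ⟨ (λ z → z ∈ˡ ys × z ∉ BV α) ⟩ ⊑ X ↓ ω ⟨ (λ z → z ∈ˡ y ∷ ys × z ∉ BV α) ⟩
    inclusion {s} q with ↓⁻ {X} {ω} {λ z → z ∈ˡ ys × z ∉ BV α} {s} q
    ... | s∈X , s≗ω = ↓⁺ {X} {ω} {_} {s} s∈X λ
      { (here refl , y∉BV) → ⊥-elim (y∉BV y∈BV) ; (there z∈ , z∉BV) → s≗ω (z∈ , z∉BV) }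
  ... | no y∉BV = ⟦ α ⟧ᵍ-mono I inclusion (∉BV {α} y∉BV I (restrict-∉BV α I ys p))
    where
    inclusion : X ↓ ω ⟨ (λ z → z ∈ˡ ys × z ∉ BV α) ⟩ ↓ ω ⟨ ｛ y ｝ ⟩ ⊑
                X ↓ ω ⟨ (λ z → z ∈ˡ y ∷ ys × z ∉ BV α) ⟩
    inclusion {s} q with ↓⁻ {X ↓ ω ⟨ (λ z → z ∈ˡ ys × z ∉ BV α) ⟩} {ω} {｛ y ｝} {s} q
    ... | q′ , sy≡ωy with ↓⁻ {X} {ω} {λ z → z ∈ˡ ys × z ∉ BV α} {s} q′
    ... | s∈X , s≗ω = ↓⁺ {X} {ω} {_} {s} s∈X λ
      { (here refl , _) → sy≡ωy refl ; (there z∈ , z∉BV) → s≗ω (z∈ , z∉BV) }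

  -- If all unbound variables are mentioned, finitely many slices suffice. Otherwise an unmentioned
  -- unbound variable lets `∉BV-tail` freeze all unmentioned variables at once, and finitely many
  -- slices freeze the rest.
  bound-effect : ∀ α I {ω X} → ω ∊ ⟦ α ⟧ᵍ I X → ω ∊ ⟦ α ⟧ᵍ I (X ↓ ω ⟨ ∁ (BV α) ⟩)
  bound-effect α I {ω} {X} p with em {∃ λ x → x ∉ˡ varsᵍ α × x ∉ BV α}
  ... | no ¬∃ = ⟦ α ⟧ᵍ-mono I inclusion (restrict-∉BV α I (varsᵍ α) p)
    where
    ∉BV⇒∈vars : ∀ {y} → y ∉ BV α → y ∈ˡ varsᵍ α
    ∉BV⇒∈vars {y} y∉BV with y ∈? varsᵍ α
    ... | yes y∈ = y∈
    ... | no y∉  = ⊥-elim (¬∃ (y , y∉ , y∉BV))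

    inclusion : X ↓ ω ⟨ (λ z → z ∈ˡ varsᵍ α × z ∉ BV α) ⟩ ⊑ X ↓ ω ⟨ ∁ (BV α) ⟩
    inclusion {s} q with ↓⁻ {X} {ω} {λ z → z ∈ˡ varsᵍ α × z ∉ BV α} {s} q
    ... | s∈X , s≗ω = ↓⁺ {X} {ω} {_} {s} s∈X λ y∉BV → s≗ω (∉BV⇒∈vars y∉BV , y∉BV)
  ... | yes (x , x∉vars , x∉BV) = ⟦ α ⟧ᵍ-mono I inclusion
      (restrict-∉BV α I (varsᵍ α) (∉BV-tail {α} {_∈ˡ varsᵍ α} id x∉vars x∉BV I p))
    where
    inclusion : X ↓ ω ⟨ ∁ (_∈ˡ varsᵍ α) ⟩ ↓ ω ⟨ (λ z → z ∈ˡ varsᵍ α × z ∉ BV α) ⟩ ⊑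
                X ↓ ω ⟨ ∁ (BV α) ⟩
    inclusion {s} q with ↓⁻ {X ↓ ω ⟨ ∁ (_∈ˡ varsᵍ α) ⟩} {ω} {λ z → z ∈ˡ varsᵍ α × z ∉ BV α} {s} q
    ... | q′ , on with ↓⁻ {X} {ω} {∁ (_∈ˡ varsᵍ α)} {s} q′
    ... | s∈X , off = ↓⁺ {X} {ω} {_} {s} s∈X λ {y} → agree y
      where
      agree : ∀ y → y ∉ BV α → s y ≡ ω y
      agree y y∉BV with y ∈? varsᵍ α
      ... | yes y∈ = on (y∈ , y∉BV)
      ... | no y∉  = off y∉

  bound-effect-⊑ : ∀ α I {ω X Y} → (∀ {s} → s ≗ ω on ∁ (BV α) → s ∊ X → s ∊ Y) →
                   ω ∊ ⟦ α ⟧ᵍ I X → ω ∊ ⟦ α ⟧ᵍ I Y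
  bound-effect-⊑ α I {ω} {X} X⊑Y p = ⟦ α ⟧ᵍ-mono I
    (λ {s} q → let s∈X , s≗ω = ↓⁻ {X} {ω} {∁ (BV α)} {s} q in X⊑Y s≗ω s∈X) (bound-effect α I p)

  bound-effect-cong : ∀ α I {ω X Y} → (∀ {s} → s ≗ ω on ∁ (BV α) → X s ≡ Y s) →
      ⟦ α ⟧ᵍ I X ω ≡ ⟦ α ⟧ᵍ I Y ω
  bound-effect-cong α I X≡Y = T-ext
    (bound-effect-⊑ α I (λ s≗ω → subst T (X≡Y s≗ω)))
      (bound-effect-⊑ α I (λ s≗ω → subst T (sym (X≡Y s≗ω))))

  -- Uniform substitution

  module _ {k : ℕ} (I : Interp) (ω : State) where
    -- The replacement is an explicit `Maybe` argument, so the equation carried by a substitution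
    -- derivation can be rewritten with `cong`.
    replaceFn : (Vector ℝ k → ℝ) → Maybe Term → Vector ℝ k → ℝ
    replaceFn F = maybe′ (λ θ d → ⟦ θ ⟧ᵗ (I ⟨ d ⟩) ω) F

    replaceFn-smooth : ∀ {F} → Smooth F → ∀ m → Smooth (replaceFn F m)
    replaceFn-smooth F-smooth (just θ) = marks-smooth I ω θ
    replaceFn-smooth F-smooth nothing  = F-smooth

    replacePr : Pow (Vector ℝ k) → Maybe Fml → Pow (Vector ℝ k)
    replacePr P = maybe′ (λ φ d → ⟦ φ ⟧ᶠ (I ⟨ d ⟩) ω) P

  replaceGm : Interp → (Pow State → Pow State) → Maybe Game → Pow State → Pow State
  replaceGm I A = maybe′ (λ α → ⟦ α ⟧ᵍ I) A

  replaceGm-mono : ∀ I {A} → (∀ {X Y} → X ⊑ Y → A X ⊑ A Y) → ∀ m {X Y} → X ⊑ Y →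
      replaceGm I A m X ⊑ replaceGm I A m Y
  replaceGm-mono I A-mono (just α) X⊑Y = ⟦ α ⟧ᵍ-mono I X⊑Y
  replaceGm-mono I A-mono nothing  X⊑Y = A-mono X⊑Y

  adjoint : Subst → State → Interp → Interp
  adjoint σ ω I = record
    { fnᴵ    = λ f → replaceFn I ω (fnᴵ I f) (fnˢ σ f)
    ; prᴵ    = λ p → replacePr I ω (prᴵ I p) (prˢ σ p)
    ; gmᴵ    = λ a → replaceGm I (gmᴵ I a) (gmˢ σ a)
    ; smooth = λ f → replaceFn-smooth I ω (smooth I f) (fnˢ σ f)
    ; mono   = λ a → replaceGm-mono I (mono I a) (gmˢ σ a)
    }

  -- Admissibility puts the free variables of the relevant replacements into ∁ W, where ω and ν
  -- agree, so coincidence equates their meanings.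
  adjoint-≃ : ∀ {σ W S} → σ is W -admissible-for S → ∀ I {ω ν} → ω ≗ ν on ∁ W →
      adjoint σ ω I ≃ adjoint σ ν I on S
  adjoint-≃ {σ} {W} {S} adm I {ω} {ν} ω≗ν = record
    { fn≡ = λ f f∈S → fn≡′ f f∈S (fnˢ σ f) refl
    ; pr≡ = λ p p∈S → pr≡′ p p∈S (prˢ σ p) refl
    ; gm≡ = λ _ _ → refl
    }
    where
    fn≡′ : ∀ {k} (f : FnSym k) → fn f ∈ S → ∀ m → fnˢ σ f ≡ m →
           replaceFn I ω (fnᴵ I f) m ≡ replaceFn I ν (fnᴵ I f) m
    fn≡′ f f∈S nothing  _  = refl
    fn≡′ f f∈S (just θ) eq = ext λ d → FV-coincidenceᵗ θ (I ⟨ d ⟩) λ x∈FV → ω≗ν λ x∈W →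
      adm (fn f f∈S eq x∈FV , x∈W)

    pr≡′ : ∀ {k} (p : Pr k) → pr p ∈ S → ∀ m → prˢ σ p ≡ m →
           replacePr I ω (prᴵ I p) m ≡ replacePr I ν (prᴵ I p) m
    pr≡′ p p∈S nothing  _  = refl
    pr≡′ p p∈S (just φ) eq = ext λ d → FV-coincidenceᶠ φ (I ⟨ d ⟩) λ x∈FV → ω≗ν λ x∈W →
      adm (pr p p∈S eq x∈FV , x∈W)

  -- A mark is a nullary symbol, so when it is replaced itself, its replacement is evaluated with an
  -- empty vector of arguments.
  ⟨⟩-nullary : ∀ I (d : Vector ℝ 0) {S} → I ⟨ d ⟩ ≃ I on S
  ⟨⟩-nullary I d = record
    { fn≡ = λ { (symbol f) _ → refl ; (· i) _ → ext (go i) }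
    ; pr≡ = λ _ _ → refl ; gm≡ = λ _ _ → refl }
    where
    go : ∀ i v → fnᴵ (I ⟨ d ⟩) (· i) v ≡ fnᴵ I (· i) v
    go i v with i ℕ.<? 0
    ... | no _ = refl

  -- Turns the auxiliary substitution of arguments into the interpretation of the marks through
  -- which `replaceFn` and `replacePr` are defined.
  adjoint-·↦ : ∀ {k} (θs : Vector Term k) I ω {S} → adjoint (·↦ θs) ω I ≃
               I ⟨ (λ i → ⟦ θs i ⟧ᵗ I ω) ⟩ on S
  adjoint-·↦ {k} θs I ω = record
    { fn≡ = λ { (symbol f) _ → refl ; (· i) _ → ext (go i) }
    ; pr≡ = λ _ _ → refl ; gm≡ = λ _ _ → refl }
    where
    go : ∀ i v → fnᴵ (adjoint (·↦ θs) ω I) (· i) v ≡ fnᴵ (I ⟨ (λ i → ⟦ θs i ⟧ᵗ I ω) ⟩) (· i) v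
    go i v with i ℕ.<? k
    ... | yes i<k = cong (λ F → F ω) (≃-coincidenceᵗ (θs (fromℕ< i<k)) (⟨⟩-nullary I v))
    ... | no  _   = refl

  -- The induction is on the derivation and not on θ: a replaced symbol leads to a derivation for
  -- the auxiliary substitution, whose term is not a subterm of θ.
  substitutionᵗ : ∀ {σ θ θ′} → σ ⟪ θ ⟫ᵗ≔ θ′ → ∀ I ω → ⟦ θ′ ⟧ᵗ I ω ≡ ⟦ θ ⟧ᵗ (adjoint σ ω I) ω

  -- The form needed below a binder of W, where the state has moved on to ν while the adjoint is
  -- still taken at ω.
  adjoint-stableᵗ : ∀ {σ W θ θ′} → σ ⟪ θ ⟫ᵗ≔ θ′ → σ is W -admissible-for Σᵗ θ →
                    ∀ I {ω ν} → ν ≗ ω on ∁ W → ⟦ θ′ ⟧ᵗ I ν ≡ ⟦ θ ⟧ᵗ (adjoint σ ω I) ν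

  substitutionᵗ var I ω = refl
  substitutionᵗ {σ} (fn-replaced {f = f} {θs} {θs′} {θ} {θ′} eq ds d) I ω = begin
    ⟦ θ′ ⟧ᵗ I ω                                             ≡⟨ substitutionᵗ d I ω ⟩
    ⟦ θ ⟧ᵗ (adjoint (·↦ θs′) ω I) ω
      ≡⟨ cong (λ F → F ω) (≃-coincidenceᵗ θ (adjoint-·↦ θs′ I ω)) ⟩
    ⟦ θ ⟧ᵗ (I ⟨ (λ i → ⟦ θs′ i ⟧ᵗ I ω) ⟩) ω
      ≡⟨ cong (λ d → ⟦ θ ⟧ᵗ (I ⟨ d ⟩) ω) (ext λ i → substitutionᵗ (ds i) I ω) ⟩
    ⟦ θ ⟧ᵗ (I ⟨ (λ i → ⟦ θs i ⟧ᵗ (adjoint σ ω I) ω) ⟩) ω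
      ≡⟨ cong (λ m → replaceFn I ω (fnᴵ I f) m (λ i → ⟦ θs i ⟧ᵗ (adjoint σ ω I) ω)) (sym eq) ⟩
    ⟦ fn f θs ⟧ᵗ (adjoint σ ω I) ω                          ∎
  substitutionᵗ {σ} (fn-kept {f = f} {θs} eq ds) I ω = trans
    (cong (fnᴵ I f) (ext λ i → substitutionᵗ (ds i) I ω))
      (cong (λ m → replaceFn I ω (fnᴵ I f) m (λ i → ⟦ θs i ⟧ᵗ (adjoint σ ω I) ω)) (sym eq))
  substitutionᵗ (d ⊕ e) I ω = cong₂ _+_ (substitutionᵗ d I ω) (substitutionᵗ e I ω)
  substitutionᵗ (d ⊗ e) I ω = cong₂ _*_ (substitutionᵗ d I ω) (substitutionᵗ e I ω)
  -- Differentiation varies the state with the adjoint held at ω. Being `U`-admissible makes the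
  -- adjoint the same at every state.
  substitutionᵗ {σ} (der {θ} adm d) I ω = cong (λ F → ∑ⱽ λ x → ω (x ′) * ∂ x F ω)
    (ext λ ν → adjoint-stableᵗ d adm I {ω} {ν} λ x∉U → ⊥-elim (x∉U tt))

  adjoint-stableᵗ {θ = θ} d adm I {ν = ν} ν≗ω =
    trans (substitutionᵗ d I ν) (cong (λ F → F ν) (≃-coincidenceᵗ θ (adjoint-≃ adm I ν≗ω)))

  -- A flow from ω changes only x and x′, so it evaluates F and Q only at states that agree with ω
  -- elsewhere.
  flow-cong : ∀ {x F G Q R X ω} → (∀ {s} → s ≗ ω on ∁ (｛ x ｝ ∪ ｛ x ′ ｝) → F s ≡ G s) →
              (∀ {s} → s ≗ ω on ∁ (｛ x ｝ ∪ ｛ x ′ ｝) → Q s ≡ R s) → Flow x F Q X ω → Flow x G R X ω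
  flow-cong {x} {ω = ω} F≡G Q≡R flow = record
    { r = r ; 0≤r = 0≤r ; φ = φ ; start = start ; end = end
    ; slope = λ ζ ζ∈ → trans (slope ζ ζ∈) (F≡G (stays ζ ζ∈))
    ; domain = λ ζ ζ∈ → subst T (Q≡R (stays ζ ζ∈)) (domain ζ ζ∈)
    ; constant = constant ; solution = solution }
    where
    open Flow flow
    stays : ∀ ζ → ζ ∈ Interval → φ ζ ≗ ω on ∁ (｛ x ｝ ∪ ｛ x ′ ｝)
    stays ζ ζ∈ y∉ = trans (constant ζ ζ∈ y∉) (start (y∉ ∘ inj₂))

  substitutionᵍ : ∀ {σ α α′} → σ ⟪ α ⟫ᵍ≔ α′ → ∀ I ω X → ⟦ α′ ⟧ᵍ I X ω ≡ ⟦ α ⟧ᵍ (adjoint σ ω I) X ω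
  substitutionᶠ : ∀ {σ φ φ′} → σ ⟪ φ ⟫ᶠ≔ φ′ → ∀ I ω → ⟦ φ′ ⟧ᶠ I ω ≡ ⟦ φ ⟧ᶠ (adjoint σ ω I) ω

  adjoint-stableᵍ : ∀ {σ W α α′} → σ ⟪ α ⟫ᵍ≔ α′ → σ is W -admissible-for Σᵍ α →
                    ∀ I {ω ν} → ν ≗ ω on ∁ W → ∀ X → ⟦ α′ ⟧ᵍ I X ν ≡ ⟦ α ⟧ᵍ (adjoint σ ω I) X ν
  adjoint-stableᵍ {α = α} d adm I {ν = ν} ν≗ω X =
    trans (substitutionᵍ d I ν X) (cong (λ A → A X ν) (≃-coincidenceᵍ α (adjoint-≃ adm I ν≗ω)))

  adjoint-stableᶠ : ∀ {σ W φ φ′} → σ ⟪ φ ⟫ᶠ≔ φ′ → σ is W -admissible-for Σᶠ φ →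
                    ∀ I {ω ν} → ν ≗ ω on ∁ W → ⟦ φ′ ⟧ᶠ I ν ≡ ⟦ φ ⟧ᶠ (adjoint σ ω I) ν
  adjoint-stableᶠ {φ = φ} d adm I {ν = ν} ν≗ω =
    trans (substitutionᶠ d I ν) (cong (λ P → P ν) (≃-coincidenceᶠ φ (adjoint-≃ adm I ν≗ω)))

  substitutionᵍ {σ} (gm-replaced {a} eq) I ω X = cong (λ m → replaceGm I (gmᴵ I a) m X ω) (sym eq)
  substitutionᵍ {σ} (gm-kept {a} eq) I ω X = cong (λ m → replaceGm I (gmᴵ I a) m X ω) (sym eq)
  substitutionᵍ (assign {x} d) I ω X = cong (λ r → X (ω [ x ↦ r ])) (substitutionᵗ d I ω)
  substitutionᵍ (ode admᵗ admᶠ d e) I ω X = em-cong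
    (flow-cong (adjoint-stableᵗ d admᵗ I) (adjoint-stableᶠ e admᶠ I))
    (flow-cong (λ p → sym (adjoint-stableᵗ d admᵗ I p)) (λ p → sym (adjoint-stableᶠ e admᶠ I p)))
  substitutionᵍ (test d) I ω X = cong (_∧ X ω) (substitutionᶠ d I ω)
  substitutionᵍ (d ∪ᵍ e) I ω X = cong₂ _∨_ (substitutionᵍ d I ω X) (substitutionᵍ e I ω X)
  -- By the bound effect of α′ the postconditions are compared only at states that agree with ω
  -- outside of `BV α′`, where admissibility keeps the adjoint fixed.
  substitutionᵍ {σ} (seq {α′ = α′} d adm e) I ω X = trans
    (bound-effect-cong α′ I λ s≗ω → adjoint-stableᵍ e adm I s≗ω X) (substitutionᵍ d I ω _)
  substitutionᵍ {σ} (loop {α} {α′} d adm) I ω X = em-cong forward backward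
    where
    J = adjoint σ ω I
    W = ∁ (BV α′)

    -- If Z is a pre-fixpoint for one of the two loops, then slice Z is one
    -- for the other.
    slice : Pow State → Pow State
    slice Z s = does (em {s ≗ ω on W → s ∊ Z})

    ∊slice⁺ : ∀ {Z s} → (s ≗ ω on W → s ∊ Z) → s ∊ slice Z
    ∊slice⁺ {Z} {s} = T-does⁺ {s ≗ ω on W → s ∊ Z} em

    ∊slice⁻ : ∀ {Z s} → s ∊ slice Z → s ≗ ω on W → s ∊ Z
    ∊slice⁻ {Z} {s} = T-does⁻ {s ≗ ω on W → s ∊ Z} em

    -- Starting in agreement with ω on W, α′ preserves this agreement, and among such states
    -- `slice Z` is contained in Z.
    from-slice : ∀ {Z s} → s ≗ ω on W → s ∊ ⟦ α′ ⟧ᵍ I (slice Z) → s ∊ ⟦ α′ ⟧ᵍ I Z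
    from-slice {Z} s≗ω = bound-effect-⊑ α′ I λ {t} t≗s p → ∊slice⁻ {Z} {t} p λ y∈W →
      trans (t≗s y∈W) (s≗ω y∈W)

    forward : (∀ Z → X ⊔ ⟦ α′ ⟧ᵍ I Z ⊑ Z → ω ∊ Z) → ∀ Z → X ⊔ ⟦ α ⟧ᵍ J Z ⊑ Z → ω ∊ Z
    forward least Z pre = ∊slice⁻ {Z} {ω}
        (least (slice Z) (⊔-⊑ {X = X} {⟦ α′ ⟧ᵍ I (slice Z)} {slice Z}
      (λ {s} p → ∊slice⁺ {Z} {s} λ _ → pre (⊑-⊔ˡ {X = X} {⟦ α ⟧ᵍ J Z} p))
      (λ {s} p → ∊slice⁺ {Z} {s} λ s≗ω → pre (⊑-⊔ʳ X {⟦ α ⟧ᵍ J Z} {s}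
        (subst T (adjoint-stableᵍ d adm I s≗ω Z) (from-slice {Z} {s} s≗ω p)))))) (λ _ → refl)

    backward : (∀ Z → X ⊔ ⟦ α ⟧ᵍ J Z ⊑ Z → ω ∊ Z) → ∀ Z → X ⊔ ⟦ α′ ⟧ᵍ I Z ⊑ Z → ω ∊ Z
    backward least Z pre = ∊slice⁻ {Z} {ω}
        (least (slice Z) (⊔-⊑ {X = X} {⟦ α ⟧ᵍ J (slice Z)} {slice Z}
      (λ {s} p → ∊slice⁺ {Z} {s} λ _ → pre (⊑-⊔ˡ {X = X} {⟦ α′ ⟧ᵍ I Z} p))
      (λ {s} p → ∊slice⁺ {Z} {s} λ s≗ω → pre (⊑-⊔ʳ X {⟦ α′ ⟧ᵍ I Z} {s}
        -- W is defined by `BV α′`, so α in J is first exchanged for α′ in I, whose bound effect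
        -- then applies.
        (from-slice {Z} {s} s≗ω (subst T (sym (adjoint-stableᵍ d adm I s≗ω (slice Z))) p))))))
          (λ _ → refl)
  substitutionᵍ (dual d) I ω X = cong not (substitutionᵍ d I ω (complement X))

  substitutionᶠ (d ≥ᶠ e) I ω = cong₂ (λ a b → does (em {b ≤ a})) (substitutionᵗ d I ω)
      (substitutionᵗ e I ω)
  substitutionᶠ {σ} (pr-replaced {p = p} {θs} {θs′} {φ} {φ′} eq ds d) I ω = begin
    ⟦ φ′ ⟧ᶠ I ω                                             ≡⟨ substitutionᶠ d I ω ⟩
    ⟦ φ ⟧ᶠ (adjoint (·↦ θs′) ω I) ω
      ≡⟨ cong (λ P → P ω) (≃-coincidenceᶠ φ (adjoint-·↦ θs′ I ω)) ⟩
    ⟦ φ ⟧ᶠ (I ⟨ (λ i → ⟦ θs′ i ⟧ᵗ I ω) ⟩) ω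
      ≡⟨ cong (λ d → ⟦ φ ⟧ᶠ (I ⟨ d ⟩) ω) (ext λ i → substitutionᵗ (ds i) I ω) ⟩
    ⟦ φ ⟧ᶠ (I ⟨ (λ i → ⟦ θs i ⟧ᵗ (adjoint σ ω I) ω) ⟩) ω
      ≡⟨ cong (λ m → replacePr I ω (prᴵ I p) m (λ i → ⟦ θs i ⟧ᵗ (adjoint σ ω I) ω)) (sym eq) ⟩
    ⟦ pr p θs ⟧ᶠ (adjoint σ ω I) ω                          ∎
  substitutionᶠ {σ} (pr-kept {p = p} {θs} eq ds) I ω = trans
    (cong (prᴵ I p) (ext λ i → substitutionᵗ (ds i) I ω))
      (cong (λ m → replacePr I ω (prᴵ I p) m (λ i → ⟦ θs i ⟧ᵗ (adjoint σ ω I) ω)) (sym eq))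
  substitutionᶠ (¬ᶠ d)   I ω = cong not (substitutionᶠ d I ω)
  substitutionᶠ (d ∧ᶠ e) I ω = cong₂ _∧_ (substitutionᶠ d I ω) (substitutionᶠ e I ω)
  substitutionᶠ (∃ᶠ {x} adm d) I ω = cong (λ P → does (em {∃ λ r → T (P r)})) (ext λ r →
    adjoint-stableᶠ d adm I λ x≢y → ↦-≢ ω r x≢y)
  substitutionᶠ (diamond {α′ = α′} d adm e) I ω = trans
    (bound-effect-cong α′ I λ s≗ω → adjoint-stableᶠ e adm I s≗ω) (substitutionᵍ d I ω _)

theorem10 : (em : ExcludedMiddle 0ℓ) → Extensionality 0ℓ 0ℓ →
    (Reals : CompleteOrderedField) (Vars : Variables) (Sig : Signature) →
    let open DGL em Reals Vars Sig in
    (σ : Subst) (φ : Fml) (adm : Admissible σ φ) →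
    Valid φ → Valid (apply σ φ adm)
theorem10 em ext Reals Vars Sig σ φ (φ′ , d) valid I ω =
  subst T (sym (substitutionᶠ d I ω)) (valid (adjoint σ ω I) ω)
  where open UniformSubstitution em ext Reals Vars Sig
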